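{- Let $\alpha$ be a $k$-adic connective that is non-linear and self-dual, and let the support of $\mu$ comprise exactly the $n$ projections and their $n$ negations. Then the growth process $(\mu,\alpha)$ has a limiting distribution, and it is uniform over the family of self-dual $n$-adic Boolean functions.
   Context: A connective is a $k$-adic Boolean function $\alpha:\{0,1\}^k\to\{0,1\}$. The initial distribution $\mu$ is uniform on its support, here the set of projections $x_1,\dots,x_n$ and negated projections $\bar x_1,\dots,\bar x_n$ on $n$ variables. The growth process $(\mu,\alpha)$ gives distributions $\pi_i$ on $n$-adic Boolean functions: $\pi_0=\mu$, and for $i\ge1$, $\pi_i(f)$ is the probability that $\alpha(g_1,\dots,g_k)=f$ where $g_1,\dots,g_k$ are independent random functions distributed according to $\pi_{i-1}$. The limiting distribution is $\pi=\lim_{i\to\infty}\pi_i$ (pointwise). A Boolean function is linear if it has the form $c_0\oplus c_1y_1\oplus\cdots\oplus c_ky_k$ with $c_j\in GF(2)$. A Boolean function $f$ of $m$ variables is self-dual if $f(y_1,\dots,y_m)=\overline{f(\bar y_1,\dots,\bar y_m)}$ for all $y$. -}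

module Defs where

open import Data.Bool.Base using (Bool; true; false; not; _∧_; _xor_; if_then_else_)
import Data.Bool.Properties as Bool
open import Data.Fin.Base using (Fin)
open import Data.List.Base as List using (List; []; _∷_; cartesianProductWith; filter)
open import Data.Nat.Base using (ℕ; zero; suc; _≥_)
open import Data.Product.Base using (_×_; _,_; ∃; ∃₂)
open import Data.Rational.Base using (ℚ; 0ℚ; 1ℚ; _+_; _*_; _-_; _≤_; _<_; ∣_∣)
open import Data.Sum.Base using (_⊎_)
open import Data.Vec.Base as Vec using (Vec; []; _∷_; lookup; zipWith; foldr′)
open import Function.Base using (_∘_)
open import Function.Bundles using (_⇔_)
open import Relation.Binary.PropositionalEquality using (_≡_; _≢_; _≗_)
open import Relation.Nullary.Decidable using (Dec; _×-dec_; map′)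

-- Boolean functions are compared by _≗_, since _≡_ on functions is not
-- extensional here.
BoolFun : ℕ → Set
BoolFun n = Vec Bool n → Bool

Linear : ∀ {k} → BoolFun k → Set
Linear {k} f = ∃₂ λ (c₀ : Bool) (c : Vec Bool k) →
  ∀ y → f y ≡ c₀ xor foldr′ _xor_ false (zipWith _∧_ c y)

SelfDual : ∀ {m} → BoolFun m → Set
SelfDual f = ∀ y → f y ≡ not (f (Vec.map not y))

projection : ∀ {n} → Fin n → BoolFun n
projection j x = lookup x j

Literal : ∀ {n} → BoolFun n → Set
Literal {n} f = ∃ λ (j : Fin n) → f ≗ projection j ⊎ f ≗ not ∘ projection j

compose : ∀ {k n} → BoolFun k → Vec (BoolFun n) k → BoolFun n
compose α gs x = α (Vec.map (λ g → g x) gs)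

_≗?_ : ∀ {n} (f g : BoolFun n) → Dec (f ≗ g)
_≗?_ {zero}  f g = map′ (λ { p [] → p }) (λ p → p []) (f [] Bool.≟ g [])
_≗?_ {suc n} f g =
  map′ (λ { (p , q) (true ∷ x) → p x ; (p , q) (false ∷ x) → q x })
       (λ p → p ∘ (true ∷_) , p ∘ (false ∷_))
       ((f ∘ (true ∷_)) ≗? (g ∘ (true ∷_)) ×-dec
        (f ∘ (false ∷_)) ≗? (g ∘ (false ∷_)))

-- Every n-adic Boolean function is _≗_ to exactly one entry of this list: a
-- function of n + 1 variables is a pair of functions of n variables, its
-- restrictions to first argument true and first argument false.
boolFuns : ∀ n → List (BoolFun n)
boolFuns zero    = (λ _ → false) ∷ (λ _ → true) ∷ []
boolFuns (suc n) = cartesianProductWith branch (boolFuns n) (boolFuns n)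
  where
  branch : BoolFun n → BoolFun n → BoolFun (suc n)
  branch f g (b ∷ x) = if b then f x else g x

tuples : ∀ {A : Set} k → List A → List (Vec A k)
tuples zero    xs = [] ∷ []
tuples (suc k) xs = cartesianProductWith _∷_ xs (tuples k xs)

∑ : List ℚ → ℚ
∑ = List.foldr _+_ 0ℚ

∏ : ∀ {k} → Vec ℚ k → ℚ
∏ = foldr′ _*_ 1ℚ

-- A distribution on n-adic Boolean functions, given by its point masses; all
-- the probabilities that occur are rational.
record IsDistribution {n} (μ : BoolFun n → ℚ) : Set where
  field
    cong   : ∀ {f g} → f ≗ g → μ f ≡ μ g
    nonNeg : ∀ f → 0ℚ ≤ μ f
    total  : ∑ (List.map μ (boolFuns n)) ≡ 1ℚ

record IsUniformOver {n} (F : BoolFun n → Set) (μ : BoolFun n → ℚ) : Set where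
  field
    isDistribution : IsDistribution μ
    support        : ∀ f → μ f ≢ 0ℚ ⇔ F f
    constant       : ∀ f g → F f → F g → μ f ≡ μ g

growth : ∀ {k n} → (BoolFun n → ℚ) → BoolFun k → ℕ → BoolFun n → ℚ
growth μ α zero    f = μ f
growth {k} {n} μ α (suc i) f =
  ∑ (List.map (λ gs → ∏ (Vec.map (growth μ α i) gs))
              (filter (λ gs → compose α gs ≗? f) (tuples k (boolFuns n))))

-- Rational tolerances suffice, as every real ε > 0 exceeds a positive rational.
_⟶_ : (ℕ → ℚ) → ℚ → Set
a ⟶ l = ∀ ε → 0ℚ < ε → ∃ λ N → ∀ i → i ≥ N → ∣ a i - l ∣ < ε

IsLimitingDistribution : ∀ {k n} → (BoolFun n → ℚ) → BoolFun k → (BoolFun n → ℚ) → Set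
IsLimitingDistribution μ α π =
  IsDistribution π × (∀ f → (λ i → growth μ α i f) ⟶ π f)

{-# OPTIONS --safe #-}
module Submission where

-- The idea is Fourier analysis over the vector space of restrictions of
-- functions to a half cube. Self-dual functions are closed under composition
-- with a self-dual connective, and they are determined by their values at the
-- points with first coordinate true, one from each pair of antipodal points.
-- A distribution on self-dual functions f is therefore determined by its
-- moments, the expectations of the product of the signs of f at the points of
-- a set S in this half cube, and it is uniform exactly when all moments of
-- nonempty S vanish. The quantitative version is ∣E-agreement-½^∣≤: if these
-- moments are at most ε in absolute value, then so is the difference between
-- the mass of any self-dual function and its mass in the uniform case. It
-- remains to show that the moments of nonempty sets tend to 0 along the growth
-- process (decays).
--
-- Let M(S) be the moments before a step and M′(S) those after it. Expanding
-- the sign of the connective α in characters at each point of S, with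
-- coefficients α̂(T), and using the independence of the arguments of α, one
-- finds that M′(S) is the sum, over all choices of a set T(x) of arguments for
-- each x in S, of the product of the α̂(T(x)) and of the moments M at the sets
-- of those x for which T(x) contains a given argument (mixed-∷, mixed-[]).
-- The diagonal terms, those with the same T for all x, contribute the sum of
-- α̂(T)^|S| M(S)^|T|; every other term contains the moment of a nonempty proper
-- subset of S, which is small by induction on |S| (moment-step-bound).
--
-- As α is balanced, the coefficient of the empty set is 0, so that the
-- diagonal part is at most c |M(S)| in absolute value, for c as follows.
-- The squares of the α̂(T) sum to 1 (parseval), none of the α̂(T) has absolute
-- value 1 and some α̂(T) with |T| ≥ 2 is nonzero, as α is not linear
-- (∣α̂∣<1, ¬degree-1).
--   * For |S| = 1 any c will do: the moments are 0 initially, by symmetry of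
--     the literals, and hence throughout.
--   * For |S| = 2 the absolute values of the moments start below a number
--     r < 1, because some literal separates the two points and some does not.
--     They stay there, and one can take for c the sum of the α̂(T)², with the
--     terms |T| ≥ 2 weighted by r (rate₂<1).
--   * For |S| ≥ 3 one can take for c the sum of the |α̂(T)|³ (rate₃<1).
-- In the last two cases c < 1, and a sequence that contracts by c up to an
-- error that tends to 0 itself tends to 0.

open import Defs
open import Data.Bool.Base using (Bool; true; false; not; _∧_; _xor_; if_then_else_)
import Data.Bool.Properties as Bool
open import Data.Fin.Base using (Fin; zero; suc)
import Data.Integer.Base as ℤ
import Data.Integer.Properties as ℤ
open import Data.List.Base as List using (List; []; _∷_; _++_; _ʳ++_; cartesianProductWith; filter; length)
open import Data.List.Membership.Propositional using (_∈_)
open import Data.List.Membership.Propositional.Properties using (∈-cartesianProductWith⁺)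
open import Data.List.Properties using (++-identityʳ; length-++)
open import Data.List.Relation.Binary.Permutation.Propositional using (↭⇒↭ₛ)
open import Data.List.Relation.Binary.Permutation.Propositional.Properties using (shift; ↭-length)
import Data.List.Relation.Binary.Permutation.Setoid.Properties as Permutation
open import Data.List.Relation.Unary.All using ([]; _∷_)
open import Data.List.Relation.Unary.AllPairs.Core using ([]; _∷_)
open import Data.List.Relation.Unary.Any using (here; there)
open import Data.List.Relation.Unary.Unique.Propositional using (Unique)
open import Data.List.Relation.Unary.Unique.Propositional.Properties using (cartesianProductWith⁺)
open import Data.Nat.Base as ℕ using (ℕ; zero; suc)
import Data.Nat.Properties as ℕ
open import Data.Product.Base using (_×_; _,_; ∃; proj₁; proj₂)
open import Data.Rational.Base as ℚ using (ℚ; 0ℚ; 1ℚ; ½; _+_; _*_; _-_; -_; _≤_; _<_; ∣_∣; 1/_)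
open import Data.Rational.Properties as ℚ
open import Data.Rational.Solver using (module +-*-Solver)
import Data.Rational.Unnormalised.Base as ℚᵘ
import Data.Rational.Unnormalised.Properties as ℚᵘ
open import Data.Sum.Base using (_⊎_; inj₁; inj₂; [_,_]′)
open import Data.Vec.Base as Vec using (Vec; []; _∷_; foldr′; lookup; zipWith)
open import Data.Vec.Properties using (≡-dec; lookup-map; ∷-injective)
open import Data.Vec.Relation.Unary.All using (All; []; _∷_)
open import Data.Vec.Relation.Unary.Any using (Any; here; there)
open import Function.Base using (_∘_)
open import Function.Bundles using (Equivalence; mk⇔)
open import Relation.Binary.PropositionalEquality
open import Relation.Nullary.Decidable using (Dec; does; yes; no; does-⇔; toWitness)
open import Relation.Nullary.Negation using (¬_; contradiction)
open +-*-Solver using (solve; _:=_; con; _:+_; _:*_; :-_; _:-_)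

private
  variable
    k k′ n : ℕ
    p q r p′ q′ : ℚ
    A B C : Set

-- Inequalities between rationals

0≤1 : 0ℚ ≤ 1ℚ
0≤1 = toWitness {a? = 0ℚ ≤? 1ℚ} _

0≤½ : 0ℚ ≤ ½
0≤½ = toWitness {a? = 0ℚ ≤? ½} _

0<½ : 0ℚ < ½
0<½ = toWitness {a? = 0ℚ <? ½} _

½<1 : ½ < 1ℚ
½<1 = toWitness {a? = ½ <? 1ℚ} _

0<1 : 0ℚ < 1ℚ
0<1 = toWitness {a? = 0ℚ <? 1ℚ} _

*-monoˡ-≤ : 0ℚ ≤ r → p ≤ q → r * p ≤ r * q
*-monoˡ-≤ {r} 0≤r = *-monoˡ-≤-nonNeg r {{ℚ.nonNegative 0≤r}}

*-monoʳ-≤ : 0ℚ ≤ r → p ≤ q → p * r ≤ q * r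
*-monoʳ-≤ {r} 0≤r = *-monoʳ-≤-nonNeg r {{ℚ.nonNegative 0≤r}}

*-monoˡ-< : 0ℚ < r → p < q → r * p < r * q
*-monoˡ-< {r} 0<r = *-monoʳ-<-pos r {{ℚ.positive 0<r}}

*-mono-≤ : 0ℚ ≤ p → p ≤ p′ → 0ℚ ≤ q → q ≤ q′ → p * q ≤ p′ * q′
*-mono-≤ 0≤p p≤p′ 0≤q q≤q′ =
  ≤-trans (*-monoʳ-≤ 0≤q p≤p′) (*-monoˡ-≤ (≤-trans 0≤p p≤p′) q≤q′)

0≤* : 0ℚ ≤ p → 0ℚ ≤ q → 0ℚ ≤ p * q
0≤* {p} 0≤p 0≤q = ≤-trans (≤-reflexive (sym (*-zeroʳ p))) (*-monoˡ-≤ 0≤p 0≤q)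

0<* : 0ℚ < p → 0ℚ < q → 0ℚ < p * q
0<* {p} 0<p 0<q = ≤-<-trans (≤-reflexive (sym (*-zeroʳ p))) (*-monoˡ-< 0<p 0<q)

0≤+ : 0ℚ ≤ p → 0ℚ ≤ q → 0ℚ ≤ p + q
0≤+ 0≤p 0≤q = +-mono-≤ 0≤p 0≤q

*-≤1 : 0ℚ ≤ p → p ≤ 1ℚ → 0ℚ ≤ q → q ≤ 1ℚ → p * q ≤ 1ℚ
*-≤1 0≤p p≤1 0≤q q≤1 = *-mono-≤ 0≤p p≤1 0≤q q≤1

p≤∣p∣ : ∀ p → p ≤ ∣ p ∣
p≤∣p∣ p with ≤-total 0ℚ p
... | inj₁ 0≤p = ≤-reflexive (sym (0≤p⇒∣p∣≡p 0≤p))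
... | inj₂ p≤0 = ≤-trans p≤0 (0≤∣p∣ p)

∣∣≤ : p ≤ q → - p ≤ q → ∣ p ∣ ≤ q
∣∣≤ {p} p≤q -p≤q with ∣p∣≡p∨∣p∣≡-p p
... | inj₁ eq = ≤-trans (≤-reflexive eq) p≤q
... | inj₂ eq = ≤-trans (≤-reflexive eq) -p≤q

≢0⇒0<∣∣ : p ≢ 0ℚ → 0ℚ < ∣ p ∣
≢0⇒0<∣∣ {p} p≢0 with 0ℚ <? ∣ p ∣
... | yes 0<∣p∣ = 0<∣p∣
... | no  0≮∣p∣ = contradiction (∣p∣≡0⇒p≡0 p (≤-antisym (≮⇒≥ 0≮∣p∣) (0≤∣p∣ p))) p≢0

∣p∣*∣p∣≡p*p : ∀ p → ∣ p ∣ * ∣ p ∣ ≡ p * p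
∣p∣*∣p∣≡p*p p with ∣p∣≡p∨∣p∣≡-p p
... | inj₁ eq = cong₂ _*_ eq eq
... | inj₂ eq = trans (cong₂ _*_ eq eq) (solve 1 (λ p → (:- p) :* (:- p) := p :* p) refl p)

<⇒0<- : p < q → 0ℚ < q - p
<⇒0<- {p} {q} p<q = ≤-<-trans (≤-reflexive (sym (+-inverseʳ p))) (+-monoˡ-< (- p) p<q)

½*p<p : 0ℚ < p → ½ * p < p
½*p<p {p} 0<p = <-≤-trans (*-monoˡ-<-pos p {{ℚ.positive 0<p}} ½<1) (≤-reflexive (*-identityˡ p))

∣p∣≤all⇒p≡0 : (∀ ε → 0ℚ < ε → ∣ p ∣ ≤ ε) → p ≡ 0ℚ
∣p∣≤all⇒p≡0 {p} h with p ≟ 0ℚ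
... | yes p≡0 = p≡0
... | no  p≢0 = contradiction (≤-<-trans (h (½ * ∣ p ∣) (0<* 0<½ 0<∣p∣)) (½*p<p 0<∣p∣)) (<-irrefl refl)
  where
  0<∣p∣ : 0ℚ < ∣ p ∣
  0<∣p∣ = ≢0⇒0<∣∣ p≢0

scale-down : ∀ K → 0ℚ ≤ K → ∀ δ → 0ℚ < δ → ∃ λ ε → 0ℚ < ε × K * ε ≤ δ
scale-down K 0≤K δ 0<δ = ε , 0<ε , (begin
  K * ε         ≤⟨ *-monoʳ-≤ (<⇒≤ 0<ε) K≤K′ ⟩
  K′ * ε        ≡⟨ solve 3 (λ k d i → k :* (d :* i) := d :* (k :* i)) refl K′ δ i ⟩
  δ * (K′ * i)  ≡⟨ cong (δ *_) (*-inverseʳ K′ {{K′≢0}}) ⟩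
  δ * 1ℚ        ≡⟨ *-identityʳ δ ⟩
  δ             ∎)
  where
  open ≤-Reasoning
  K′ : ℚ
  K′ = K + 1ℚ
  K≤K′ : K ≤ K′
  K≤K′ = ≤-trans (≤-reflexive (sym (+-identityʳ K))) (+-monoʳ-≤ K 0≤1)
  0<K′ : 0ℚ < K′
  0<K′ = +-mono-≤-< 0≤K 0<1
  K′≢0 : ℚ.NonZero K′
  K′≢0 = pos⇒nonZero K′ {{ℚ.positive 0<K′}}
  i : ℚ
  i = (1/ K′) {{K′≢0}}
  0<i : 0ℚ < i
  0<i = positive⁻¹ i {{1/pos⇒pos K′ {{ℚ.positive 0<K′}}}}
  ε : ℚ
  ε = δ * i
  0<ε : 0ℚ < ε
  0<ε = 0<* 0<δ 0<i

-- The sum of n copies of p.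
_copies_ : ℕ → ℚ → ℚ
zero  copies p = 0ℚ
suc n copies p = p + n copies p

private
  fromNat : ℕ → ℚ
  fromNat n = ℤ.+ n ℚ./ 1

  fromNat-suc : ∀ n → fromNat (suc n) ≡ 1ℚ + fromNat n
  fromNat-suc n = toℚᵘ-injective (begin
    ℚ.toℚᵘ (fromNat (suc n))                ≈⟨ toℚᵘ-fromℚᵘ (ℚᵘ.mkℚᵘ (ℤ.+ suc n) 0) ⟩
    ℚᵘ.mkℚᵘ (ℤ.+ suc n) 0                     ≈⟨ ℚᵘ.*≡* (cong (ℤ._* ℤ.+ 1) lemma) ⟩
    ℚᵘ.1ℚᵘ ℚᵘ.+ ℚᵘ.mkℚᵘ (ℤ.+ n) 0             ≈⟨ ℚᵘ.+-congʳ ℚᵘ.1ℚᵘ (ℚᵘ.≃-sym (toℚᵘ-fromℚᵘ (ℚᵘ.mkℚᵘ (ℤ.+ n) 0))) ⟩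
    ℚ.toℚᵘ 1ℚ ℚᵘ.+ ℚ.toℚᵘ (fromNat n)       ≈⟨ ℚᵘ.≃-sym (toℚᵘ-homo-+ 1ℚ (fromNat n)) ⟩
    ℚ.toℚᵘ (1ℚ + fromNat n)                 ∎)
    where
    open ℚᵘ.≃-Reasoning
    lemma : ℤ.+ suc n ≡ ℤ.+ 1 ℤ.* ℤ.+ 1 ℤ.+ ℤ.+ n ℤ.* ℤ.+ 1
    lemma = cong (λ z → ℤ.+ 1 ℤ.+ z) (sym (ℤ.*-identityʳ (ℤ.+ n)))

  copies-fromNat : ∀ n p → n copies p ≡ fromNat n * p
  copies-fromNat zero    p = sym (*-zeroˡ p)
  copies-fromNat (suc n) p = begin
    p + n copies p          ≡⟨ cong (_+_ p) (copies-fromNat n p) ⟩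
    p + fromNat n * p       ≡⟨ solve 2 (λ p n → p :+ n :* p := (con 1ℚ :+ n) :* p) refl p (fromNat n) ⟩
    (1ℚ + fromNat n) * p    ≡⟨ cong (_* p) (sym (fromNat-suc n)) ⟩
    fromNat (suc n) * p     ∎
    where open ≡-Reasoning

  ≤-fromNat : ∀ p → ∃ λ n → p ≤ fromNat n
  ≤-fromNat p = ℤ.∣ ℚ.↥ p ∣ , toℚᵘ-cancel-≤ (ℚᵘ.≤-respʳ-≃ (ℚᵘ.≃-sym (toℚᵘ-fromℚᵘ (ℚᵘ.mkℚᵘ (ℤ.+ ℤ.∣ ℚ.↥ p ∣) 0))) (bound p))
    where
    bound : ∀ p → ℚ.toℚᵘ p ℚᵘ.≤ ℚᵘ.mkℚᵘ (ℤ.+ ℤ.∣ ℚ.↥ p ∣) 0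
    bound (ℚ.mkℚ (ℤ.+ zero)      d _) = ℚᵘ.*≤* ℤ.≤-refl
    bound (ℚ.mkℚ (ℤ.+ n@(suc _)) d _) = ℚᵘ.*≤* (ℤ.*-monoˡ-≤-nonNeg (ℤ.+ n) (ℤ.+≤+ (ℕ.s≤s ℕ.z≤n)))
    bound (ℚ.mkℚ (ℤ.-[1+ n ])  d _) = ℚᵘ.*≤* ℤ.-≤+

archimedean : ∀ p → 0ℚ < p → ∃ λ n → 1ℚ ≤ n copies p
archimedean p 0<p = N , (begin
  1ℚ                        ≡⟨ sym (*-inverseˡ p {{p≢0}}) ⟩
  (1/ p) {{p≢0}} * p        ≤⟨ *-monoʳ-≤ (<⇒≤ 0<p) (proj₂ bound) ⟩
  fromNat N * p             ≡⟨ sym (copies-fromNat N p) ⟩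
  N copies p                ∎)
  where
  open ≤-Reasoning
  p≢0 : ℚ.NonZero p
  p≢0 = pos⇒nonZero p {{ℚ.positive 0<p}}
  bound : ∃ λ n → (1/ p) {{p≢0}} ≤ fromNat n
  bound = ≤-fromNat ((1/ p) {{p≢0}})
  N : ℕ
  N = proj₁ bound

-- Finite sums

sum : List A → (A → ℚ) → ℚ
sum xs F = ∑ (List.map F xs)

-- The summand extends over products but not over sums.
infixr 6.5 sum

syntax sum xs (λ x → F) = ∑[ x ∈ xs ] F

sum-cong : ∀ xs {F G : A → ℚ} → (∀ x → F x ≡ G x) → sum xs F ≡ sum xs G
sum-cong []       F≗G = refl
sum-cong (x ∷ xs) F≗G = cong₂ _+_ (F≗G x) (sum-cong xs F≗G)

sum-mono : ∀ xs {F G : A → ℚ} → (∀ x → F x ≤ G x) → sum xs F ≤ sum xs G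
sum-mono []       F≤G = ≤-refl
sum-mono (x ∷ xs) F≤G = +-mono-≤ (F≤G x) (sum-mono xs F≤G)

sum-mono-< : ∀ {xs} {F G : A → ℚ} → (∀ x → F x ≤ G x) →
             ∀ {x} → x ∈ xs → F x < G x → sum xs F < sum xs G
sum-mono-< {xs = x ∷ xs} F≤G (here refl) Fx<Gx = +-mono-<-≤ Fx<Gx (sum-mono xs F≤G)
sum-mono-< {xs = x ∷ xs} F≤G (there y∈)  Fy<Gy = +-mono-≤-< (F≤G x) (sum-mono-< F≤G y∈ Fy<Gy)

sum-0 : ∀ (xs : List A) → ∑[ x ∈ xs ] 0ℚ ≡ 0ℚ
sum-0 []       = refl
sum-0 (x ∷ xs) = trans (+-identityˡ _) (sum-0 xs)

sum-nonNeg : ∀ xs {F : A → ℚ} → (∀ x → 0ℚ ≤ F x) → 0ℚ ≤ sum xs F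
sum-nonNeg xs 0≤F = ≤-trans (≤-reflexive (sym (sum-0 xs))) (sum-mono xs 0≤F)

sum-+ : ∀ xs (F G : A → ℚ) → ∑[ x ∈ xs ] (F x + G x) ≡ sum xs F + sum xs G
sum-+ []       F G = refl
sum-+ (x ∷ xs) F G = begin
  (F x + G x) + sum xs (λ x → F x + G x)   ≡⟨ cong (_+_ (F x + G x)) (sum-+ xs F G) ⟩
  (F x + G x) + (sum xs F + sum xs G)      ≡⟨ solve 4 (λ a b c d → (a :+ b) :+ (c :+ d) := (a :+ c) :+ (b :+ d))
                                                refl (F x) (G x) (sum xs F) (sum xs G) ⟩
  (F x + sum xs F) + (G x + sum xs G)      ∎
  where open ≡-Reasoning

sum-*ˡ : ∀ xs r (F : A → ℚ) → ∑[ x ∈ xs ] (r * F x) ≡ r * sum xs F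
sum-*ˡ []       r F = sym (*-zeroʳ r)
sum-*ˡ (x ∷ xs) r F = trans (cong (_+_ (r * F x)) (sum-*ˡ xs r F)) (sym (*-distribˡ-+ r (F x) (sum xs F)))

sum-*ʳ : ∀ xs r (F : A → ℚ) → ∑[ x ∈ xs ] (F x * r) ≡ sum xs F * r
sum-*ʳ xs r F = trans (sum-cong xs (λ x → *-comm (F x) r)) (trans (sum-*ˡ xs r F) (*-comm r (sum xs F)))

sum-neg : ∀ xs (F : A → ℚ) → ∑[ x ∈ xs ] (- F x) ≡ - sum xs F
sum-neg []       F = refl
sum-neg (x ∷ xs) F = trans (cong (_+_ (- F x)) (sum-neg xs F)) (sym (neg-distrib-+ (F x) (sum xs F)))

sum-- : ∀ xs (F G : A → ℚ) → ∑[ x ∈ xs ] (F x - G x) ≡ sum xs F - sum xs G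
sum-- xs F G = trans (sum-+ xs F (-_ ∘ G)) (cong (_+_ (sum xs F)) (sum-neg xs G))

∣sum∣≤sum∣∣ : ∀ xs (F : A → ℚ) → ∣ sum xs F ∣ ≤ ∑[ x ∈ xs ] ∣ F x ∣
∣sum∣≤sum∣∣ []       F = ≤-refl
∣sum∣≤sum∣∣ (x ∷ xs) F = ≤-trans (∣p+q∣≤∣p∣+∣q∣ (F x) (sum xs F)) (+-monoʳ-≤ ∣ F x ∣ (∣sum∣≤sum∣∣ xs F))

sum-swap : ∀ (xs : List A) (ys : List B) (F : A → B → ℚ) →
           ∑[ x ∈ xs ] ∑[ y ∈ ys ] F x y ≡ ∑[ y ∈ ys ] ∑[ x ∈ xs ] F x y
sum-swap []       ys F = sym (sum-0 ys)
sum-swap (x ∷ xs) ys F = trans (cong (_+_ (sum ys (F x))) (sum-swap xs ys F))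
                               (sym (sum-+ ys (F x) (λ y → ∑[ x ∈ xs ] F x y)))

sum-++ : ∀ (xs ys : List A) (F : A → ℚ) → sum (xs ++ ys) F ≡ sum xs F + sum ys F
sum-++ []       ys F = sym (+-identityˡ _)
sum-++ (x ∷ xs) ys F = trans (cong (_+_ (F x)) (sum-++ xs ys F)) (sym (+-assoc (F x) (sum xs F) (sum ys F)))

sum-map : ∀ (h : A → B) xs (F : B → ℚ) → sum (List.map h xs) F ≡ sum xs (F ∘ h)
sum-map h []       F = refl
sum-map h (x ∷ xs) F = cong (_+_ (F (h x))) (sum-map h xs F)

sum-cartesianProductWith : ∀ (h : A → B → C) xs ys (F : C → ℚ) →
  sum (cartesianProductWith h xs ys) F ≡ ∑[ x ∈ xs ] ∑[ y ∈ ys ] F (h x y)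
sum-cartesianProductWith h []       ys F = refl
sum-cartesianProductWith h (x ∷ xs) ys F =
  trans (sum-++ (List.map (h x) ys) (cartesianProductWith h xs ys) F)
        (cong₂ _+_ (sum-map (h x) ys F) (sum-cartesianProductWith h xs ys F))

sum-filter : ∀ {P : A → Set} (P? : ∀ x → Dec (P x)) xs (F : A → ℚ) →
  sum (filter P? xs) F ≡ ∑[ x ∈ xs ] (if does (P? x) then F x else 0ℚ)
sum-filter P? []       F = refl
sum-filter P? (x ∷ xs) F with does (P? x)
... | true  = cong (_+_ (F x)) (sum-filter P? xs F)
... | false = trans (sum-filter P? xs F) (sym (+-identityˡ _))

if-cases : ∀ {P : Set} (P? : Dec P) (x y : ℚ) →
  P × (if does P? then x else y) ≡ x ⊎ (¬ P) × (if does P? then x else y) ≡ y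
if-cases (yes p) x y = inj₁ (p , refl)
if-cases (no ¬p) x y = inj₂ (¬p , refl)

-- Signs, powers and the Boolean cube

-- The character of the two-element group, turning xor into multiplication.
sign : Bool → ℚ
sign false = 1ℚ
sign true  = - 1ℚ

sign-xor : ∀ a b → sign (a xor b) ≡ sign a * sign b
sign-xor false b     = sym (*-identityˡ (sign b))
sign-xor true  false = refl
sign-xor true  true  = refl

sign-not : ∀ b → sign (not b) ≡ - sign b
sign-not false = refl
sign-not true  = refl

sign² : ∀ b → sign b * sign b ≡ 1ℚ
sign² false = refl
sign² true  = refl

∣sign∣ : ∀ b → ∣ sign b ∣ ≡ 1ℚ
∣sign∣ false = refl
∣sign∣ true  = refl

sign≤1 : ∀ b → sign b ≤ 1ℚ
sign≤1 b = ≤-trans (p≤∣p∣ (sign b)) (≤-reflexive (∣sign∣ b))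

1≤sign⇒false : ∀ b → 1ℚ ≤ sign b → b ≡ false
1≤sign⇒false false _ = refl
1≤sign⇒false true  h = contradiction (<-≤-trans (toWitness {a? = - 1ℚ <? 1ℚ} _) h) (<-irrefl refl)

xor≡false⇒≡ : ∀ a b → a xor b ≡ false → b ≡ a
xor≡false⇒≡ false false _ = refl
xor≡false⇒≡ true  true  _ = refl

∣sign*∣ : ∀ b p → ∣ sign b * p ∣ ≡ ∣ p ∣
∣sign*∣ b p = trans (∣p*q∣≡∣p∣*∣q∣ (sign b) p) (trans (cong (_* ∣ p ∣) (∣sign∣ b)) (*-identityˡ ∣ p ∣))

infixr 8 _^_

_^_ : ℚ → ℕ → ℚ
p ^ zero  = 1ℚ
p ^ suc n = p * p ^ n

0≤^ : ∀ n → 0ℚ ≤ p → 0ℚ ≤ p ^ n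
0≤^ zero    0≤p = 0≤1
0≤^ (suc n) 0≤p = 0≤* 0≤p (0≤^ n 0≤p)

^≤1 : ∀ n → 0ℚ ≤ p → p ≤ 1ℚ → p ^ n ≤ 1ℚ
^≤1 zero    0≤p p≤1 = ≤-refl
^≤1 (suc n) 0≤p p≤1 = *-≤1 0≤p p≤1 (0≤^ n 0≤p) (^≤1 n 0≤p p≤1)

-- All Boolean vectors of length k.
cube : ∀ k → List (Vec Bool k)
cube k = tuples k (true ∷ false ∷ [])

∈-cube : (y : Vec Bool k) → y ∈ cube k
∈-cube []          = here refl
∈-cube (true  ∷ y) = ∈-cartesianProductWith⁺ _∷_ {xs = true ∷ false ∷ []} (here refl) (∈-cube y)
∈-cube (false ∷ y) = ∈-cartesianProductWith⁺ _∷_ {xs = true ∷ false ∷ []} (there (here refl)) (∈-cube y)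

sum-cube : ∀ (F : Vec Bool (suc k) → ℚ) →
  sum (cube (suc k)) F ≡ sum (cube k) (F ∘ (true ∷_)) + sum (cube k) (F ∘ (false ∷_))
sum-cube {k} F = trans (sum-cartesianProductWith _∷_ (true ∷ false ∷ []) (cube k) F)
                       (cong (_+_ (sum (cube k) (F ∘ (true ∷_)))) (+-identityʳ _))

-- Fourier analysis on the Boolean cube

-- Subsets of the coordinates are encoded by their indicator vectors.
weight : Vec Bool k → ℕ
weight []          = 0
weight (true  ∷ T) = suc (weight T)
weight (false ∷ T) = weight T

-- The inner product over the field with two elements.
dot : Vec Bool k → Vec Bool k → Bool
dot T y = foldr′ _xor_ false (zipWith _∧_ T y)

-- The character of the cube that belongs to the set T.
χ : Vec Bool k → Vec Bool k → ℚ
χ T y = sign (dot T y)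

-- The coefficient of F at T is the average of F y * χ T y over the cube, here
-- computed one coordinate at a time.
hat : (Vec Bool k → ℚ) → Vec Bool k → ℚ
hat F []      = F []
hat F (b ∷ T) = ½ * (hat (F ∘ (false ∷_)) T + sign b * hat (F ∘ (true ∷_)) T)

hat-cong : ∀ {F G : Vec Bool k → ℚ} → F ≗ G → hat F ≗ hat G
hat-cong F≗G []      = F≗G []
hat-cong F≗G (b ∷ T) = cong₂ (λ x y → ½ * (x + sign b * y))
  (hat-cong (F≗G ∘ (false ∷_)) T) (hat-cong (F≗G ∘ (true ∷_)) T)

hat-neg : ∀ (F : Vec Bool k → ℚ) T → hat (-_ ∘ F) T ≡ - hat F T
hat-neg F []      = refl
hat-neg F (b ∷ T) = trans
  (cong₂ (λ x y → ½ * (x + sign b * y)) (hat-neg (F ∘ (false ∷_)) T) (hat-neg (F ∘ (true ∷_)) T))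
  (solve 3 (λ x s y → con ½ :* ((:- x) :+ s :* (:- y)) := :- (con ½ :* (x :+ s :* y)))
     refl (hat (F ∘ (false ∷_)) T) (sign b) (hat (F ∘ (true ∷_)) T))

fourier-inversion : ∀ (F : Vec Bool k → ℚ) y → F y ≡ ∑[ T ∈ cube k ] hat F T * χ T y
fourier-inversion F [] = sym (trans (+-identityʳ _) (*-identityʳ _))
fourier-inversion {suc k} F (c ∷ y) = sym (begin
  ∑[ T ∈ cube (suc k) ] hat F T * χ T (c ∷ y)
    ≡⟨ sum-cube (λ T → hat F T * χ T (c ∷ y)) ⟩
  ∑[ T ∈ cube k ] hat F (true ∷ T) * χ (true ∷ T) (c ∷ y) +
  ∑[ T ∈ cube k ] hat F (false ∷ T) * χ T y
    ≡⟨ sym (sum-+ (cube k) _ _) ⟩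
  ∑[ T ∈ cube k ] (hat F (true ∷ T) * χ (true ∷ T) (c ∷ y) + hat F (false ∷ T) * χ T y)
    ≡⟨ sum-cong (cube k) (λ T → merge c T) ⟩
  ∑[ T ∈ cube k ] hat (F ∘ (c ∷_)) T * χ T y
    ≡⟨ sym (fourier-inversion (F ∘ (c ∷_)) y) ⟩
  F (c ∷ y) ∎)
  where
  open ≡-Reasoning
  merge : ∀ c T → hat F (true ∷ T) * χ (true ∷ T) (c ∷ y) + hat F (false ∷ T) * χ T y
                  ≡ hat (F ∘ (c ∷_)) T * χ T y
  merge false T = solve 3 (λ x z w → con ½ :* (x :+ con (- 1ℚ) :* z) :* w :+ con ½ :* (x :+ con 1ℚ :* z) :* w := x :* w)
    refl (hat (F ∘ (false ∷_)) T) (hat (F ∘ (true ∷_)) T) (χ T y)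
  merge true T = trans
    (cong (λ v → hat F (true ∷ T) * v + hat F (false ∷ T) * χ T y) (sign-not (dot T y)))
    (solve 3 (λ x z w → con ½ :* (x :+ con (- 1ℚ) :* z) :* (:- w) :+ con ½ :* (x :+ con 1ℚ :* z) :* w := z :* w)
       refl (hat (F ∘ (false ∷_)) T) (hat (F ∘ (true ∷_)) T) (χ T y))

parseval : ∀ (F : Vec Bool k → ℚ) → (∀ y → F y * F y ≡ 1ℚ) →
  ∑[ T ∈ cube k ] hat F T * hat F T ≡ 1ℚ
parseval {zero}  F F² = trans (+-identityʳ _) (F² [])
parseval {suc k} F F² = begin
  ∑[ T ∈ cube (suc k) ] hat F T * hat F T
    ≡⟨ sum-cube (λ T → hat F T * hat F T) ⟩
  ∑[ T ∈ cube k ] hat F (true ∷ T) * hat F (true ∷ T) +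
  ∑[ T ∈ cube k ] hat F (false ∷ T) * hat F (false ∷ T)
    ≡⟨ sym (sum-+ (cube k) _ _) ⟩
  ∑[ T ∈ cube k ] (hat F (true ∷ T) * hat F (true ∷ T) + hat F (false ∷ T) * hat F (false ∷ T))
    ≡⟨ sum-cong (cube k) (λ T → parallelogram (F₀ T) (F₁ T)) ⟩
  ∑[ T ∈ cube k ] ½ * (F₀ T * F₀ T + F₁ T * F₁ T)
    ≡⟨ sum-*ˡ (cube k) ½ _ ⟩
  ½ * (∑[ T ∈ cube k ] (F₀ T * F₀ T + F₁ T * F₁ T))
    ≡⟨ cong (½ *_) (sum-+ (cube k) _ _) ⟩
  ½ * (∑[ T ∈ cube k ] F₀ T * F₀ T + ∑[ T ∈ cube k ] F₁ T * F₁ T)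
    ≡⟨ cong₂ (λ x y → ½ * (x + y)) (parseval (F ∘ (false ∷_)) (F² ∘ (false ∷_)))
                                   (parseval (F ∘ (true ∷_)) (F² ∘ (true ∷_))) ⟩
  1ℚ ∎
  where
  open ≡-Reasoning
  F₀ F₁ : Vec Bool k → ℚ
  F₀ = hat (F ∘ (false ∷_))
  F₁ = hat (F ∘ (true ∷_))
  parallelogram : ∀ x z → (½ * (x + - 1ℚ * z)) * (½ * (x + - 1ℚ * z)) + (½ * (x + 1ℚ * z)) * (½ * (x + 1ℚ * z))
                         ≡ ½ * (x * x + z * z)
  parallelogram = solve 2 (λ x z → (con ½ :* (x :+ con (- 1ℚ) :* z)) :* (con ½ :* (x :+ con (- 1ℚ) :* z))
                               :+ (con ½ :* (x :+ con 1ℚ :* z)) :* (con ½ :* (x :+ con 1ℚ :* z))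
                              := con ½ :* (x :* x :+ z :* z)) refl

∣hat∣≤1 : ∀ (F : Vec Bool k → ℚ) → (∀ y → ∣ F y ∣ ≤ 1ℚ) → ∀ T → ∣ hat F T ∣ ≤ 1ℚ
∣hat∣≤1 F ∣F∣≤1 []      = ∣F∣≤1 []
∣hat∣≤1 F ∣F∣≤1 (b ∷ T) = begin
  ∣ ½ * (F₀ + sign b * F₁) ∣        ≡⟨ ∣p*q∣≡∣p∣*∣q∣ ½ (F₀ + sign b * F₁) ⟩
  ½ * ∣ F₀ + sign b * F₁ ∣          ≤⟨ *-monoˡ-≤ 0≤½ (∣p+q∣≤∣p∣+∣q∣ F₀ (sign b * F₁)) ⟩
  ½ * (∣ F₀ ∣ + ∣ sign b * F₁ ∣)    ≡⟨ cong (λ x → ½ * (∣ F₀ ∣ + x)) (∣sign*∣ b F₁) ⟩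
  ½ * (∣ F₀ ∣ + ∣ F₁ ∣)             ≤⟨ *-monoˡ-≤ 0≤½ (+-mono-≤ (∣hat∣≤1 _ (∣F∣≤1 ∘ (false ∷_)) T)
                                                               (∣hat∣≤1 _ (∣F∣≤1 ∘ (true ∷_)) T)) ⟩
  1ℚ                                ∎
  where
  open ≤-Reasoning
  F₀ F₁ : ℚ
  F₀ = hat (F ∘ (false ∷_)) T
  F₁ = hat (F ∘ (true ∷_)) T

-- An average of numbers at most 1 reaches 1 only if all of them do.
average-extremal : p ≤ 1ℚ → q ≤ 1ℚ → 1ℚ ≤ ½ * (p + q) → 1ℚ ≤ p × 1ℚ ≤ q
average-extremal {p} {q} p≤1 q≤1 h = one p≤1 q≤1 h , one q≤1 p≤1 (≤-trans h (≤-reflexive (cong (½ *_) (+-comm p q))))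
  where
  one : ∀ {p q} → p ≤ 1ℚ → q ≤ 1ℚ → 1ℚ ≤ ½ * (p + q) → 1ℚ ≤ p
  one {p} {q} p≤1 q≤1 h with 1ℚ ≤? p
  ... | yes 1≤p = 1≤p
  ... | no  1≰p = contradiction (<-≤-trans (*-monoˡ-< 0<½ (+-mono-<-≤ (≰⇒> 1≰p) q≤1)) h)
                                (<-irrefl refl)

-- A function bounded by 1 with a coefficient of absolute value 1 is, up to
-- sign, the corresponding character.
hat-extremal : ∀ (F : Vec Bool k → ℚ) → (∀ y → ∣ F y ∣ ≤ 1ℚ) → ∀ c T →
  1ℚ ≤ sign c * hat F T → ∀ y → 1ℚ ≤ sign c * (χ T y * F y)
hat-extremal F ∣F∣≤1 c [] h [] = ≤-trans h (≤-reflexive (cong (sign c *_) (sym (*-identityˡ (F [])))))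
hat-extremal F ∣F∣≤1 c (b ∷ T) h (d ∷ y) = both d
  where
  F₀ F₁ : ℚ
  F₀ = hat (F ∘ (false ∷_)) T
  F₁ = hat (F ∘ (true ∷_)) T
  signed≤1 : ∀ c (G : Vec Bool _ → ℚ) → (∀ y → ∣ G y ∣ ≤ 1ℚ) → sign c * hat G T ≤ 1ℚ
  signed≤1 c G ∣G∣≤1 = ≤-trans (p≤∣p∣ _) (≤-trans (≤-reflexive (∣sign*∣ c (hat G T))) (∣hat∣≤1 G ∣G∣≤1 T))
  halves : 1ℚ ≤ sign c * F₀ × 1ℚ ≤ sign (c xor b) * F₁
  halves = average-extremal (signed≤1 c _ (∣F∣≤1 ∘ (false ∷_))) (signed≤1 (c xor b) _ (∣F∣≤1 ∘ (true ∷_)))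
    (≤-trans h (≤-reflexive (trans
      (solve 4 (λ s x t z → s :* (con ½ :* (x :+ t :* z)) := con ½ :* (s :* x :+ (s :* t) :* z))
         refl (sign c) F₀ (sign b) F₁)
      (cong (λ v → ½ * (sign c * F₀ + v * F₁)) (sym (sign-xor c b))))))
  both : ∀ d → 1ℚ ≤ sign c * (χ (b ∷ T) (d ∷ y) * F (d ∷ y))
  both false = ≤-trans (hat-extremal (F ∘ (false ∷_)) (∣F∣≤1 ∘ (false ∷_)) c T (proj₁ halves) y)
    (≤-reflexive (cong (λ e → sign c * (sign (e xor dot T y) * F (false ∷ y))) (sym (Bool.∧-zeroʳ b))))
  both true  = ≤-trans (hat-extremal (F ∘ (true ∷_)) (∣F∣≤1 ∘ (true ∷_)) (c xor b) T (proj₂ halves) y)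
    (≤-reflexive (begin
      sign (c xor b) * (χ T y * F (true ∷ y))
        ≡⟨ cong (_* (χ T y * F (true ∷ y))) (sign-xor c b) ⟩
      (sign c * sign b) * (χ T y * F (true ∷ y))
        ≡⟨ solve 4 (λ s t x z → (s :* t) :* (x :* z) := s :* ((t :* x) :* z))
             refl (sign c) (sign b) (χ T y) (F (true ∷ y)) ⟩
      sign c * ((sign b * χ T y) * F (true ∷ y))
        ≡⟨ cong (λ v → sign c * (v * F (true ∷ y))) (sym (sign-xor b (dot T y))) ⟩
      sign c * (sign (b xor dot T y) * F (true ∷ y))
        ≡⟨ cong (λ e → sign c * (sign (e xor dot T y) * F (true ∷ y))) (sym (Bool.∧-identityʳ b)) ⟩
      sign c * (χ (b ∷ T) (true ∷ y) * F (true ∷ y)) ∎))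
    where
    open ≡-Reasoning

hat-extremal⇒Linear : ∀ (f : BoolFun k) c T → 1ℚ ≤ sign c * hat (sign ∘ f) T → Linear f
hat-extremal⇒Linear f c T h = c , T , λ y → xor≡false⇒≡ (c xor dot T y) (f y)
  (1≤sign⇒false _ (≤-trans (hat-extremal (sign ∘ f) (λ y → ≤-reflexive (∣sign∣ (f y))) c T h y)
    (≤-reflexive (begin
      sign c * (χ T y * sign (f y))   ≡⟨ sym (*-assoc (sign c) (χ T y) (sign (f y))) ⟩
      (sign c * χ T y) * sign (f y)   ≡⟨ cong (_* sign (f y)) (sym (sign-xor c (dot T y))) ⟩
      sign (c xor dot T y) * sign (f y) ≡⟨ sym (sign-xor (c xor dot T y) (f y)) ⟩
      sign ((c xor dot T y) xor f y) ∎))))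
  where open ≡-Reasoning

-- The average over the cube is invariant under complementing the arguments.
hat-reflect : ∀ (F : Vec Bool k → ℚ) T → weight T ≡ 0 → hat (F ∘ Vec.map not) T ≡ hat F T
hat-reflect F []          _ = refl
hat-reflect F (false ∷ T) w = trans
  (cong₂ (λ x y → ½ * (x + 1ℚ * y)) (hat-reflect (F ∘ (true ∷_)) T w) (hat-reflect (F ∘ (false ∷_)) T w))
  (solve 2 (λ x y → con ½ :* (x :+ con 1ℚ :* y) := con ½ :* (y :+ con 1ℚ :* x))
     refl (hat (F ∘ (true ∷_)) T) (hat (F ∘ (false ∷_)) T))

≡-⇒≡0 : p ≡ - p → p ≡ 0ℚ
≡-⇒≡0 {p} p≡-p = begin
  p              ≡⟨ solve 1 (λ p → p := con ½ :* (p :+ p)) refl p ⟩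
  ½ * (p + p)    ≡⟨ cong (λ x → ½ * (p + x)) p≡-p ⟩
  ½ * (p - p)    ≡⟨ cong (½ *_) (+-inverseʳ p) ⟩
  0ℚ             ∎
  where open ≡-Reasoning

-- Self-dual functions are balanced.
selfDual-hat-∅ : ∀ {f : BoolFun k} → SelfDual f → ∀ T → weight T ≡ 0 → hat (sign ∘ f) T ≡ 0ℚ
selfDual-hat-∅ {f = f} dual T w = ≡-⇒≡0 (begin
  hat (sign ∘ f) T                       ≡⟨ hat-cong (λ y → trans (cong sign (dual y)) (sign-not (f (Vec.map not y)))) T ⟩
  hat (-_ ∘ sign ∘ f ∘ Vec.map not) T    ≡⟨ hat-neg (sign ∘ f ∘ Vec.map not) T ⟩
  - hat (sign ∘ f ∘ Vec.map not) T       ≡⟨ cong -_ (hat-reflect (sign ∘ f) T w) ⟩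
  - hat (sign ∘ f) T                     ∎)
  where open ≡-Reasoning

dot-∅ : ∀ (T y : Vec Bool k) → weight T ≡ 0 → dot T y ≡ false
dot-∅ []          []      _ = refl
dot-∅ (false ∷ T) (c ∷ y) w = dot-∅ T y w

weight≡0-unique : ∀ (T U : Vec Bool k) → weight T ≡ 0 → weight U ≡ 0 → T ≡ U
weight≡0-unique []          []          _ _ = refl
weight≡0-unique (false ∷ T) (false ∷ U) t u = cong (false ∷_) (weight≡0-unique T U t u)

weight-∅ : ∀ k → weight (Vec.replicate k false) ≡ 0
weight-∅ zero    = refl
weight-∅ (suc k) = weight-∅ k

-- A homogeneous linear form attains the sum of the absolute values of its
-- coefficients, at the point whose coordinates have the matching signs.
align-signs : ∀ (c : Vec Bool k → ℚ) → (∀ T → weight T ≢ 1 → c T ≡ 0ℚ) →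
  ∃ λ y → ∀ T → c T * χ T y ≡ ∣ c T ∣
align-signs {zero}  c c≡0 = [] , λ { [] → trans (*-identityʳ (c [])) (trans c[]≡0 (sym (cong ∣_∣ c[]≡0))) }
  where
  c[]≡0 : c [] ≡ 0ℚ
  c[]≡0 = c≡0 [] (λ ())
align-signs {suc k} c c≡0 with align-signs (c ∘ (false ∷_)) (c≡0 ∘ (false ∷_))
... | y , aligned = b ∷ y , λ { (false ∷ T) → aligned T ; (true ∷ T) → head T }
  where
  e₁ : Vec Bool (suc k)
  e₁ = true ∷ Vec.replicate k false
  signBit : ∃ λ b → c e₁ * sign b ≡ ∣ c e₁ ∣
  signBit with ∣p∣≡p∨∣p∣≡-p (c e₁)
  ... | inj₁ eq = false , trans (*-identityʳ (c e₁)) (sym eq)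
  ... | inj₂ eq = true  , trans (solve 1 (λ x → x :* con (- 1ℚ) := :- x) refl (c e₁)) (sym eq)
  b : Bool
  b = proj₁ signBit
  head : ∀ T → c (true ∷ T) * sign (b xor dot T y) ≡ ∣ c (true ∷ T) ∣
  head T with weight T ℕ.≟ 0
  ... | no  w≢0 = trans (cong (_* sign (b xor dot T y)) ≡0) (trans (*-zeroˡ (sign (b xor dot T y))) (sym (cong ∣_∣ ≡0)))
    where
    ≡0 : c (true ∷ T) ≡ 0ℚ
    ≡0 = c≡0 (true ∷ T) (w≢0 ∘ cong ℕ.pred)
  ... | yes w≡0 with weight≡0-unique T (Vec.replicate k false) w≡0 (weight-∅ k)
  ...   | refl = begin
    c e₁ * sign (b xor dot (Vec.replicate k false) y)  ≡⟨ cong (λ e → c e₁ * sign (b xor e)) (dot-∅ (Vec.replicate k false) y w≡0) ⟩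
    c e₁ * sign (b xor false)     ≡⟨ cong (c e₁ *_) (trans (sign-xor b false) (*-identityʳ (sign b))) ⟩
    c e₁ * sign b                 ≡⟨ proj₂ signBit ⟩
    ∣ c e₁ ∣                      ∎
    where open ≡-Reasoning

module Coefficients {α : BoolFun k} (nonlinear : ¬ Linear α) (dual : SelfDual α) where

  α̂ : Vec Bool k → ℚ
  α̂ = hat (sign ∘ α)

  α̂-parseval : ∑[ T ∈ cube k ] α̂ T * α̂ T ≡ 1ℚ
  α̂-parseval = parseval (sign ∘ α) (sign² ∘ α)

  α̂-∅ : ∀ T → weight T ≡ 0 → α̂ T ≡ 0ℚ
  α̂-∅ = selfDual-hat-∅ dual

  ∣α̂∣<1 : ∀ T → ∣ α̂ T ∣ < 1ℚ
  ∣α̂∣<1 T with ∣ α̂ T ∣ <? 1ℚ | ∣p∣≡p∨∣p∣≡-p (α̂ T)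
  ... | yes h | _       = h
  ... | no ≮1 | inj₁ eq = contradiction (hat-extremal⇒Linear α false T
    (≤-trans (≮⇒≥ ≮1) (≤-reflexive (trans eq (sym (*-identityˡ (α̂ T))))))) nonlinear
  ... | no ≮1 | inj₂ eq = contradiction (hat-extremal⇒Linear α true T
    (≤-trans (≮⇒≥ ≮1) (≤-reflexive (trans eq (solve 1 (λ x → :- x := con (- 1ℚ) :* x) refl (α̂ T)))))) nonlinear

  ∣α̂∣≤1 : ∀ T → ∣ α̂ T ∣ ≤ 1ℚ
  ∣α̂∣≤1 T = <⇒≤ (∣α̂∣<1 T)

  square≤∣∣ : ∀ T → α̂ T * α̂ T ≤ ∣ α̂ T ∣
  square≤∣∣ T = begin
    α̂ T * α̂ T           ≡⟨ sym (∣p∣*∣p∣≡p*p (α̂ T)) ⟩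
    ∣ α̂ T ∣ * ∣ α̂ T ∣   ≤⟨ *-monoˡ-≤ (0≤∣p∣ (α̂ T)) (∣α̂∣≤1 T) ⟩
    ∣ α̂ T ∣ * 1ℚ        ≡⟨ *-identityʳ ∣ α̂ T ∣ ⟩
    ∣ α̂ T ∣             ∎
    where open ≤-Reasoning

  square<∣∣ : ∀ T → α̂ T ≢ 0ℚ → α̂ T * α̂ T < ∣ α̂ T ∣
  square<∣∣ T ≢0 = begin-strict
    α̂ T * α̂ T           ≡⟨ sym (∣p∣*∣p∣≡p*p (α̂ T)) ⟩
    ∣ α̂ T ∣ * ∣ α̂ T ∣   <⟨ *-monoˡ-< (≢0⇒0<∣∣ ≢0) (∣α̂∣<1 T) ⟩
    ∣ α̂ T ∣ * 1ℚ        ≡⟨ *-identityʳ ∣ α̂ T ∣ ⟩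
    ∣ α̂ T ∣             ∎
    where open ≤-Reasoning

  -- If α̂ lived on the singletons, the corresponding linear form would attain
  -- the sum of its absolute values, which exceeds the sum of its squares, 1.
  ¬degree-1 : ¬ (∀ T → 2 ℕ.≤ weight T → α̂ T ≡ 0ℚ)
  ¬degree-1 ≥2⇒0 = 0≢1 (trans (sym (sum-0 (cube k))) (trans (sum-cong (cube k) (λ T → sym (square≡0 T))) α̂-parseval))
    where
    ≢1⇒0 : ∀ T → weight T ≢ 1 → α̂ T ≡ 0ℚ
    ≢1⇒0 T w≢1 with weight T in eq
    ... | 0             = α̂-∅ T eq
    ... | 1             = contradiction refl w≢1
    ... | suc (suc w)   = ≥2⇒0 T (subst (2 ℕ.≤_) (sym eq) (ℕ.s≤s (ℕ.s≤s ℕ.z≤n)))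
    y : Vec Bool k
    y = proj₁ (align-signs α̂ ≢1⇒0)
    sum∣∣≤1 : ∑[ T ∈ cube k ] ∣ α̂ T ∣ ≤ 1ℚ
    sum∣∣≤1 = ≤-trans (≤-reflexive (trans
      (sum-cong (cube k) (λ T → sym (proj₂ (align-signs α̂ ≢1⇒0) T)))
      (sym (fourier-inversion (sign ∘ α) y)))) (sign≤1 (α y))
    ≡0 : ∀ T → α̂ T ≡ 0ℚ
    ≡0 T with α̂ T ≟ 0ℚ
    ... | yes eq = eq
    ... | no ≢0  = contradiction
      (<-≤-trans (≤-<-trans (≤-reflexive (sym α̂-parseval)) (sum-mono-< square≤∣∣ (∈-cube T) (square<∣∣ T ≢0))) sum∣∣≤1)
      (<-irrefl refl)
    square≡0 : ∀ T → α̂ T * α̂ T ≡ 0ℚ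
    square≡0 T = trans (cong (_* α̂ T) (≡0 T)) (*-zeroˡ (α̂ T))
    0≢1 : 0ℚ ≢ 1ℚ
    0≢1 ()

  -- A sum dominated by the squares of the coefficients, and strictly so
  -- wherever a coefficient of weight at least 2 is nonzero, is below 1.
  sum-below-squares : ∀ (G : Vec Bool k → ℚ) → (∀ T → G T ≤ α̂ T * α̂ T) →
    (∀ T → 2 ℕ.≤ weight T → α̂ T ≢ 0ℚ → G T < α̂ T * α̂ T) → ∑[ T ∈ cube k ] G T < 1ℚ
  sum-below-squares G G≤ G< with ∑[ T ∈ cube k ] G T <? 1ℚ
  ... | yes h = h
  ... | no ≮1 = contradiction (λ T 2≤w → vanish T 2≤w) ¬degree-1
    where
    vanish : ∀ T → 2 ℕ.≤ weight T → α̂ T ≡ 0ℚ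
    vanish T 2≤w with α̂ T ≟ 0ℚ
    ... | yes eq = eq
    ... | no ≢0  = contradiction
      (<-≤-trans (sum-mono-< G≤ (∈-cube T) (G< T 2≤w ≢0)) (≤-reflexive α̂-parseval)) ≮1

  -- For w ≥ 1, ρ r w bounds p ^ (w - 1) whenever 0 ≤ p ≤ r ≤ 1. The value at
  -- w = 0 does not matter, as α̂ vanishes at the empty set.
  ρ : ℚ → ℕ → ℚ
  ρ r (suc (suc w)) = r
  ρ r w             = 1ℚ

  ρ≤1 : r ≤ 1ℚ → ∀ w → ρ r w ≤ 1ℚ
  ρ≤1 r≤1 0             = ≤-refl
  ρ≤1 r≤1 1             = ≤-refl
  ρ≤1 r≤1 (suc (suc w)) = r≤1

  0≤square : ∀ T → 0ℚ ≤ α̂ T * α̂ T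
  0≤square T = ≤-trans (0≤* (0≤∣p∣ (α̂ T)) (0≤∣p∣ (α̂ T))) (≤-reflexive (∣p∣*∣p∣≡p*p (α̂ T)))

  0<square : ∀ T → α̂ T ≢ 0ℚ → 0ℚ < α̂ T * α̂ T
  0<square T ≢0 = <-≤-trans (0<* (≢0⇒0<∣∣ ≢0) (≢0⇒0<∣∣ ≢0)) (≤-reflexive (∣p∣*∣p∣≡p*p (α̂ T)))

  -- The contraction rate for pairs of points with moments bounded by r.
  rate₂ : ℚ → ℚ
  rate₂ r = ∑[ T ∈ cube k ] (α̂ T * α̂ T) * ρ r (weight T)

  rate₂<1 : r < 1ℚ → rate₂ r < 1ℚ
  rate₂<1 {r} r<1 = sum-below-squares _
    (λ T → ≤-trans (*-monoˡ-≤ (0≤square T) (ρ≤1 (<⇒≤ r<1) (weight T))) (≤-reflexive (*-identityʳ _)))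
    (λ T 2≤w ≢0 → <-≤-trans (*-monoˡ-< (0<square T ≢0) (ρ<1 2≤w)) (≤-reflexive (*-identityʳ _)))
    where
    ρ<1 : ∀ {w} → 2 ℕ.≤ w → ρ r w < 1ℚ
    ρ<1 (ℕ.s≤s (ℕ.s≤s _)) = r<1

  -- The contraction rate for sets of at least three points.
  rate₃ : ℚ
  rate₃ = ∑[ T ∈ cube k ] ∣ α̂ T ∣ ^ 3

  cube≡ : ∀ T → ∣ α̂ T ∣ ^ 3 ≡ (α̂ T * α̂ T) * ∣ α̂ T ∣
  cube≡ T = trans (solve 1 (λ x → x :* (x :* (x :* con 1ℚ)) := (x :* x) :* x) refl ∣ α̂ T ∣)
                  (cong (_* ∣ α̂ T ∣) (∣p∣*∣p∣≡p*p (α̂ T)))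

  rate₃<1 : rate₃ < 1ℚ
  rate₃<1 = sum-below-squares _
    (λ T → ≤-trans (≤-reflexive (cube≡ T)) (≤-trans (*-monoˡ-≤ (0≤square T) (∣α̂∣≤1 T)) (≤-reflexive (*-identityʳ _))))
    (λ T _ ≢0 → ≤-<-trans (≤-reflexive (cube≡ T)) (<-≤-trans (*-monoˡ-< (0<square T ≢0) (∣α̂∣<1 T)) (≤-reflexive (*-identityʳ _))))

  -- A bound on the diagonal terms in the expansion of the next moment of a set
  -- of m points, where p is the absolute value of its present moment.
  diagonal : ℕ → ℚ → ℚ
  diagonal m p = ∑[ T ∈ cube k ] ∣ α̂ T ∣ ^ m * p ^ weight T

  diagonal-zero : ∀ m → diagonal (suc m) 0ℚ ≡ 0ℚ
  diagonal-zero m = trans (sum-cong (cube k) term) (sum-0 (cube k))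
    where
    term : ∀ T → ∣ α̂ T ∣ ^ suc m * 0ℚ ^ weight T ≡ 0ℚ
    term T with weight T in eq
    ... | suc w = trans (cong (∣ α̂ T ∣ ^ suc m *_) (*-zeroˡ (0ℚ ^ w))) (*-zeroʳ (∣ α̂ T ∣ ^ suc m))
    ... | zero  = trans (cong (λ x → (∣ x ∣ * ∣ α̂ T ∣ ^ m) * 1ℚ) (α̂-∅ T eq))
                        (solve 1 (λ x → (con 0ℚ :* x) :* con 1ℚ := con 0ℚ) refl (∣ α̂ T ∣ ^ m))

  diagonal-2 : 0ℚ ≤ p → p ≤ r → r < 1ℚ → diagonal 2 p ≤ rate₂ r * p
  diagonal-2 {p} {r} 0≤p p≤r r<1 = ≤-trans (sum-mono (cube k) term) (≤-reflexive (sum-*ʳ (cube k) p _))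
    where
    0≤r : 0ℚ ≤ r
    0≤r = ≤-trans 0≤p p≤r
    term : ∀ T → ∣ α̂ T ∣ ^ 2 * p ^ weight T ≤ ((α̂ T * α̂ T) * ρ r (weight T)) * p
    term T with weight T in eq
    ... | 0 = ≤-reflexive (trans (cong (λ x → ∣ x ∣ ^ 2 * 1ℚ) (α̂-∅ T eq))
                (sym (trans (cong (λ x → ((x * x) * 1ℚ) * p) (α̂-∅ T eq))
                (*-zeroˡ p))))
    ... | 1 = ≤-reflexive (trans (cong (λ x → (∣ α̂ T ∣ * x) * (p * 1ℚ)) (*-identityʳ ∣ α̂ T ∣))
                (trans (cong (_* (p * 1ℚ)) (∣p∣*∣p∣≡p*p (α̂ T)))
                (solve 2 (λ s p → s :* (p :* con 1ℚ) := (s :* con 1ℚ) :* p) refl (α̂ T * α̂ T) p)))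
    ... | suc (suc w) = begin
      ∣ α̂ T ∣ ^ 2 * (p * (p * p ^ w))   ≡⟨ cong (λ x → (∣ α̂ T ∣ * x) * (p * (p * p ^ w))) (*-identityʳ ∣ α̂ T ∣) ⟩
      (∣ α̂ T ∣ * ∣ α̂ T ∣) * (p * (p * p ^ w)) ≡⟨ cong (_* (p * (p * p ^ w))) (∣p∣*∣p∣≡p*p (α̂ T)) ⟩
      (α̂ T * α̂ T) * (p * (p * p ^ w))   ≤⟨ *-monoˡ-≤ (0≤square T) (*-monoˡ-≤ 0≤p
                                             (*-mono-≤ 0≤p p≤r (0≤^ w 0≤p) (^≤1 w 0≤p (≤-trans p≤r (<⇒≤ r<1))))) ⟩
      (α̂ T * α̂ T) * (p * (r * 1ℚ))      ≡⟨ solve 3 (λ s p r → s :* (p :* (r :* con 1ℚ)) := (s :* r) :* p) refl (α̂ T * α̂ T) p r ⟩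
      ((α̂ T * α̂ T) * r) * p             ∎
      where open ≤-Reasoning

  diagonal-≥3 : ∀ m → 0ℚ ≤ p → p ≤ 1ℚ → diagonal (3 ℕ.+ m) p ≤ rate₃ * p
  diagonal-≥3 {p} m 0≤p p≤1 = ≤-trans (sum-mono (cube k) term) (≤-reflexive (sum-*ʳ (cube k) p _))
    where
    a : Vec Bool k → ℚ
    a T = ∣ α̂ T ∣
    term : ∀ T → a T ^ (3 ℕ.+ m) * p ^ weight T ≤ a T ^ 3 * p
    term T with weight T in eq
    ... | 0     = ≤-reflexive (trans (cong (λ x → (∣ x ∣ * (a T * (a T * a T ^ m))) * 1ℚ) (α̂-∅ T eq))
                    (trans (solve 1 (λ x → (con 0ℚ :* x) :* con 1ℚ := con 0ℚ) refl (a T * (a T * a T ^ m)))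
                    (sym (trans (cong (λ x → ∣ x ∣ ^ 3 * p) (α̂-∅ T eq)) (*-zeroˡ p)))))
    ... | suc w = *-mono-≤ (0≤^ (3 ℕ.+ m) 0≤a) a^≤ (0≤^ (suc w) 0≤p)
                    (≤-trans (*-monoˡ-≤ 0≤p (^≤1 w 0≤p p≤1)) (≤-reflexive (*-identityʳ p)))
      where
      0≤a : 0ℚ ≤ a T
      0≤a = 0≤∣p∣ (α̂ T)
      a^≤ : a T ^ (3 ℕ.+ m) ≤ a T ^ 3
      a^≤ = *-monoˡ-≤ 0≤a (*-monoˡ-≤ 0≤a (*-monoˡ-≤ 0≤a (^≤1 m 0≤a (∣α̂∣≤1 T))))

-- Summation over all Boolean functions

-- Functions of Boolean functions that respect pointwise equality.
Extensional : (BoolFun n → ℚ) → Set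
Extensional φ = ∀ {f g} → f ≗ g → φ f ≡ φ g

-- The enumeration of functions of n + 1 variables runs over pairs of
-- functions of n variables, combined by a function known up to _≗_.
boolFuns-suc : ∀ n → ∃ λ (branch : BoolFun n → BoolFun n → BoolFun (suc n)) →
  (∀ f g → branch f g ∘ (true ∷_) ≗ f) × (∀ f g → branch f g ∘ (false ∷_) ≗ g) ×
  boolFuns (suc n) ≡ cartesianProductWith branch (boolFuns n) (boolFuns n)
boolFuns-suc n = _ , (λ _ _ _ → refl) , (λ _ _ _ → refl) , refl

≗-split : ∀ {f g : BoolFun (suc n)} → f ∘ (true ∷_) ≗ g ∘ (true ∷_) → f ∘ (false ∷_) ≗ g ∘ (false ∷_) → f ≗ g
≗-split t f (true  ∷ x) = t x
≗-split t f (false ∷ x) = f x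

if-∧ : ∀ a b {x y : ℚ} → (if a ∧ b then x else y) ≡ (if a then (if b then x else y) else y)
if-∧ true  b = refl
if-∧ false b = refl

sum-if : ∀ b (xs : List A) (F : A → ℚ) →
  ∑[ x ∈ xs ] (if b then F x else 0ℚ) ≡ (if b then sum xs F else 0ℚ)
sum-if true  xs F = refl
sum-if false xs F = sum-0 xs

-- Each Boolean function occurs exactly once in the enumeration.
sum-≗? : ∀ {φ : BoolFun n → ℚ} → Extensional φ → ∀ h →
  ∑[ f ∈ boolFuns n ] (if does (h ≗? f) then φ f else 0ℚ) ≡ φ h
sum-≗? {zero} {φ} φ-ext h with h [] in eq
... | false = trans (cong (_+_ (φ (λ _ → false))) (+-identityˡ _))
                    (trans (+-identityʳ _) (φ-ext (λ { [] → sym eq })))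
... | true  = trans (+-identityˡ _) (trans (+-identityʳ _) (φ-ext (λ { [] → sym eq })))
sum-≗? {suc n} {φ} φ-ext h with boolFuns-suc n
... | branch , onTrue , onFalse , enum = begin
  sum (boolFuns (suc n)) F
    ≡⟨ cong (λ fs → sum fs F) enum ⟩
  sum (cartesianProductWith branch (boolFuns n) (boolFuns n)) F
    ≡⟨ sum-cartesianProductWith branch (boolFuns n) (boolFuns n) F ⟩
  ∑[ f ∈ boolFuns n ] ∑[ g ∈ boolFuns n ] F (branch f g)
    ≡⟨ sum-cong (boolFuns n) (λ f → sum-cong (boolFuns n) (λ g → split f g)) ⟩
  ∑[ f ∈ boolFuns n ] ∑[ g ∈ boolFuns n ] (if does (h₁ ≗? f) then G f g else 0ℚ)
    ≡⟨ sum-cong (boolFuns n) (λ f → sum-if (does (h₁ ≗? f)) (boolFuns n) (G f)) ⟩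
  ∑[ f ∈ boolFuns n ] (if does (h₁ ≗? f) then sum (boolFuns n) (G f) else 0ℚ)
    ≡⟨ sum-cong (boolFuns n) (λ f → cong (λ x → if does (h₁ ≗? f) then x else 0ℚ)
         (sum-≗? (λ g≗g′ → φ-ext (branch-cong (λ _ → refl) g≗g′)) h₀)) ⟩
  ∑[ f ∈ boolFuns n ] (if does (h₁ ≗? f) then φ (branch f h₀) else 0ℚ)
    ≡⟨ sum-≗? (λ f≗f′ → φ-ext (branch-cong f≗f′ (λ _ → refl))) h₁ ⟩
  φ (branch h₁ h₀)
    ≡⟨ φ-ext (≗-split (onTrue h₁ h₀) (onFalse h₁ h₀)) ⟩
  φ h ∎
  where
  open ≡-Reasoning
  h₁ h₀ : BoolFun n
  h₁ = h ∘ (true ∷_)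
  h₀ = h ∘ (false ∷_)
  F : BoolFun (suc n) → ℚ
  F f = if does (h ≗? f) then φ f else 0ℚ
  G : BoolFun n → BoolFun n → ℚ
  G f g = if does (h₀ ≗? g) then φ (branch f g) else 0ℚ
  branch-cong : ∀ {f f′ g g′} → f ≗ f′ → g ≗ g′ → branch f g ≗ branch f′ g′
  branch-cong {f} {f′} {g} {g′} f≗f′ g≗g′ = ≗-split
    (λ x → trans (onTrue f g x) (trans (f≗f′ x) (sym (onTrue f′ g′ x))))
    (λ x → trans (onFalse f g x) (trans (g≗g′ x) (sym (onFalse f′ g′ x))))
  does-trans : ∀ (a b b′ : BoolFun n) → b ≗ b′ → does (a ≗? b) ≡ does (a ≗? b′)
  does-trans a b b′ b≗b′ = does-⇔ (mk⇔ (λ e x → trans (e x) (b≗b′ x)) (λ e x → trans (e x) (sym (b≗b′ x))))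
                                  (a ≗? b) (a ≗? b′)
  split : ∀ f g → F (branch f g) ≡ (if does (h₁ ≗? f) then G f g else 0ℚ)
  split f g = trans
    (if-∧ (does (h₁ ≗? (branch f g ∘ (true ∷_)))) (does (h₀ ≗? (branch f g ∘ (false ∷_)))))
    (cong₂ (λ a b → if a then (if b then φ (branch f g) else 0ℚ) else 0ℚ)
      (does-trans h₁ _ f (onTrue f g)) (does-trans h₀ _ g (onFalse f g)))

sum-complement : ∀ {φ : BoolFun n → ℚ} → Extensional φ →
  ∑[ f ∈ boolFuns n ] φ (not ∘ f) ≡ sum (boolFuns n) φ
sum-complement {zero}  {φ} φ-ext = solve 2 (λ a b → b :+ (a :+ con 0ℚ) := a :+ (b :+ con 0ℚ)) refl
                                           (φ (λ _ → false)) (φ (λ _ → true))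
sum-complement {suc n} {φ} φ-ext with boolFuns-suc n
... | branch , onTrue , onFalse , enum = begin
  ∑[ f ∈ boolFuns (suc n) ] φ (not ∘ f)
    ≡⟨ cong (λ fs → sum fs (φ ∘ (not ∘_))) enum ⟩
  sum (cartesianProductWith branch (boolFuns n) (boolFuns n)) (φ ∘ (not ∘_))
    ≡⟨ sum-cartesianProductWith branch (boolFuns n) (boolFuns n) (φ ∘ (not ∘_)) ⟩
  ∑[ f ∈ boolFuns n ] ∑[ g ∈ boolFuns n ] φ (not ∘ branch f g)
    ≡⟨ sum-cong (boolFuns n) (λ f → trans
         (sum-cong (boolFuns n) (λ g → φ-ext (≗-split
           (λ x → trans (cong not (onTrue f g x)) (sym (onTrue _ _ x)))
           (λ x → trans (cong not (onFalse f g x)) (sym (onFalse _ _ x))))))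
         (sum-complement {φ = λ g → φ (branch (not ∘ f) g)} (λ g≗g′ → φ-ext (≗-split
           (λ x → trans (onTrue _ _ x) (sym (onTrue _ _ x)))
           (λ x → trans (onFalse _ _ x) (trans (g≗g′ x) (sym (onFalse _ _ x)))))))) ⟩
  ∑[ f ∈ boolFuns n ] ∑[ g ∈ boolFuns n ] φ (branch (not ∘ f) g)
    ≡⟨ sum-complement {φ = λ f → ∑[ g ∈ boolFuns n ] φ (branch f g)}
         (λ f≗f′ → sum-cong (boolFuns n) (λ g → φ-ext (≗-split
           (λ x → trans (onTrue _ _ x) (trans (f≗f′ x) (sym (onTrue _ _ x))))
           (λ x → trans (onFalse _ _ x) (sym (onFalse _ _ x)))))) ⟩
  ∑[ f ∈ boolFuns n ] ∑[ g ∈ boolFuns n ] φ (branch f g)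
    ≡⟨ sym (sum-cartesianProductWith branch (boolFuns n) (boolFuns n) φ) ⟩
  sum (cartesianProductWith branch (boolFuns n) (boolFuns n)) φ
    ≡⟨ cong (λ fs → sum fs φ) (sym enum) ⟩
  sum (boolFuns (suc n)) φ ∎
  where open ≡-Reasoning

-- Expectations and the growth step

-- The expectation of φ for the point masses p.
E : (BoolFun n → ℚ) → (BoolFun n → ℚ) → ℚ
E {n} p φ = ∑[ f ∈ boolFuns n ] p f * φ f

E-cong : ∀ (p : BoolFun n → ℚ) {φ ψ : BoolFun n → ℚ} → (∀ f → φ f ≡ ψ f) → E p φ ≡ E p ψ
E-cong {n} p φ≗ψ = sum-cong (boolFuns n) (λ f → cong (p f *_) (φ≗ψ f))

-- Independence: the expectation of a product of functions of the separate
-- members of a random tuple is the product of their expectations.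
sum-tuples-∏ : ∀ (xs : List A) (p : A → ℚ) (ψ : B → A → ℚ) (bs : Vec B k) →
  ∑[ gs ∈ tuples k xs ] ∏ (Vec.map p gs) * ∏ (zipWith ψ bs gs) ≡
  ∏ (Vec.map (λ b → ∑[ g ∈ xs ] p g * ψ b g) bs)
sum-tuples-∏ xs p ψ [] = trans (+-identityʳ _) (*-identityˡ _)
sum-tuples-∏ {k = suc k} xs p ψ (b ∷ bs) = begin
  sum (tuples (suc k) xs) (λ gs → ∏ (Vec.map p gs) * ∏ (zipWith ψ (b ∷ bs) gs))
    ≡⟨ sum-cartesianProductWith _∷_ xs (tuples k xs) _ ⟩
  ∑[ g ∈ xs ] ∑[ gs ∈ tuples k xs ] (p g * P gs) * (ψ b g * Q gs)
    ≡⟨ sum-cong xs (λ g → trans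
         (sum-cong (tuples k xs) (λ gs → solve 4 (λ a b c d → (a :* b) :* (c :* d) := (a :* c) :* (b :* d))
                                            refl (p g) (P gs) (ψ b g) (Q gs)))
         (sum-*ˡ (tuples k xs) (p g * ψ b g) (λ gs → P gs * Q gs))) ⟩
  ∑[ g ∈ xs ] (p g * ψ b g) * (∑[ gs ∈ tuples k xs ] P gs * Q gs)
    ≡⟨ sum-*ʳ xs _ (λ g → p g * ψ b g) ⟩
  (∑[ g ∈ xs ] p g * ψ b g) * (∑[ gs ∈ tuples k xs ] P gs * Q gs)
    ≡⟨ cong ((∑[ g ∈ xs ] p g * ψ b g) *_) (sum-tuples-∏ xs p ψ bs) ⟩
  ∏ (Vec.map (λ b → ∑[ g ∈ xs ] p g * ψ b g) (b ∷ bs)) ∎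
  where
  open ≡-Reasoning
  P Q : Vec _ k → ℚ
  P gs = ∏ (Vec.map p gs)
  Q gs = ∏ (zipWith ψ bs gs)

-- One step of the growth process: growth μ α (suc i) is
-- step α (growth μ α i) by definition.
step : BoolFun k → (BoolFun n → ℚ) → BoolFun n → ℚ
step {k} {n} α p f = ∑[ gs ∈ filter (λ gs → compose α gs ≗? f) (tuples k (boolFuns n)) ] ∏ (Vec.map p gs)

if-*ʳ : ∀ b (x y : ℚ) → (if b then x else 0ℚ) * y ≡ (if b then x * y else 0ℚ)
if-*ʳ true  x y = refl
if-*ʳ false x y = *-zeroˡ y

if-*ˡ : ∀ b (x y : ℚ) → (if b then x * y else 0ℚ) ≡ x * (if b then y else 0ℚ)
if-*ˡ true  x y = refl
if-*ˡ false x y = sym (*-zeroʳ x)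

step-if : ∀ (α : BoolFun k) (p : BoolFun n → ℚ) f →
  step α p f ≡ ∑[ gs ∈ tuples k (boolFuns n) ] (if does (compose α gs ≗? f) then ∏ (Vec.map p gs) else 0ℚ)
step-if {k} {n} α p f = sum-filter (λ gs → compose α gs ≗? f) (tuples k (boolFuns n)) _

E-step : ∀ (α : BoolFun k) (p : BoolFun n → ℚ) {φ : BoolFun n → ℚ} → Extensional φ →
  E (step α p) φ ≡ ∑[ gs ∈ tuples k (boolFuns n) ] ∏ (Vec.map p gs) * φ (compose α gs)
E-step {k} {n} α p {φ} φ-ext = begin
  ∑[ f ∈ fs ] step α p f * φ f
    ≡⟨ sum-cong fs (λ f → trans (cong (_* φ f) (step-if α p f)) (sym (sum-*ʳ ts (φ f) _))) ⟩
  ∑[ f ∈ fs ] ∑[ gs ∈ ts ] (if does (compose α gs ≗? f) then P gs else 0ℚ) * φ f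
    ≡⟨ sum-swap fs ts _ ⟩
  ∑[ gs ∈ ts ] ∑[ f ∈ fs ] (if does (compose α gs ≗? f) then P gs else 0ℚ) * φ f
    ≡⟨ sum-cong ts (λ gs → trans
         (sum-cong fs (λ f → trans (if-*ʳ (does (compose α gs ≗? f)) (P gs) (φ f))
                                   (if-*ˡ (does (compose α gs ≗? f)) (P gs) (φ f))))
         (sum-*ˡ fs (P gs) _)) ⟩
  ∑[ gs ∈ ts ] P gs * (∑[ f ∈ fs ] (if does (compose α gs ≗? f) then φ f else 0ℚ))
    ≡⟨ sum-cong ts (λ gs → cong (P gs *_) (sum-≗? φ-ext (compose α gs))) ⟩
  ∑[ gs ∈ ts ] P gs * φ (compose α gs) ∎
  where
  open ≡-Reasoning
  fs : List (BoolFun n)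
  fs = boolFuns n
  ts : List (Vec (BoolFun n) k)
  ts = tuples k fs
  P : Vec (BoolFun n) k → ℚ
  P gs = ∏ (Vec.map p gs)

∏-nonNeg : ∀ {p : A → ℚ} → (∀ x → 0ℚ ≤ p x) → (xs : Vec A k) → 0ℚ ≤ ∏ (Vec.map p xs)
∏-nonNeg 0≤p []       = 0≤1
∏-nonNeg 0≤p (x ∷ xs) = 0≤* (0≤p x) (∏-nonNeg 0≤p xs)

∏-ones : ∀ (bs : Vec B k) {F : B → ℚ} → (∀ b → F b ≡ 1ℚ) → ∏ (Vec.map F bs) ≡ 1ℚ
∏-ones []       F≡1 = refl
∏-ones (b ∷ bs) F≡1 = trans (cong₂ _*_ (F≡1 b) (∏-ones bs F≡1)) (*-identityˡ 1ℚ)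

sum-tuples-∏1 : ∀ k (xs : List A) (p : A → ℚ) → sum xs p ≡ 1ℚ → ∑[ gs ∈ tuples k xs ] ∏ (Vec.map p gs) ≡ 1ℚ
sum-tuples-∏1 zero    xs p total = refl
sum-tuples-∏1 (suc k) xs p total = begin
  ∑[ gs ∈ tuples (suc k) xs ] ∏ (Vec.map p gs)
    ≡⟨ sum-cartesianProductWith _∷_ xs (tuples k xs) _ ⟩
  ∑[ g ∈ xs ] ∑[ gs ∈ tuples k xs ] p g * ∏ (Vec.map p gs)
    ≡⟨ sum-cong xs (λ g → trans (sum-*ˡ (tuples k xs) (p g) _)
         (trans (cong (p g *_) (sum-tuples-∏1 k xs p total)) (*-identityʳ (p g)))) ⟩
  sum xs p
    ≡⟨ total ⟩
  1ℚ ∎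
  where open ≡-Reasoning

E-1 : ∀ {p : BoolFun n → ℚ} → IsDistribution p → E p (λ _ → 1ℚ) ≡ 1ℚ
E-1 {n} dist = trans (sum-cong (boolFuns n) (λ f → *-identityʳ _)) (IsDistribution.total dist)

step-isDistribution : ∀ (α : BoolFun k) {p : BoolFun n → ℚ} → IsDistribution p → IsDistribution (step α p)
step-isDistribution {k} {n} α {p} dist = record
  { cong   = λ {f} {g} f≗g → trans (step-if α p f) (trans
      (sum-cong (tuples k (boolFuns n)) (λ gs → cong (λ b → if b then ∏ (Vec.map p gs) else 0ℚ)
        (does-⇔ (mk⇔ (λ e x → trans (e x) (f≗g x)) (λ e x → trans (e x) (sym (f≗g x))))
                (compose α gs ≗? f) (compose α gs ≗? g))))
      (sym (step-if α p g)))
  ; nonNeg = λ f → sum-nonNeg (filter (λ gs → compose α gs ≗? f) (tuples k (boolFuns n))) (∏-nonNeg nonNeg)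
  ; total  = begin
      sum (boolFuns n) (step α p)     ≡⟨ sum-cong (boolFuns n) (λ f → sym (*-identityʳ _)) ⟩
      E (step α p) (λ _ → 1ℚ)         ≡⟨ E-step α p (λ _ → refl) ⟩
      ∑[ gs ∈ tuples k (boolFuns n) ] ∏ (Vec.map p gs) * 1ℚ
        ≡⟨ sum-cong (tuples k (boolFuns n)) (λ gs → *-identityʳ _) ⟩
      ∑[ gs ∈ tuples k (boolFuns n) ] ∏ (Vec.map p gs)
        ≡⟨ sum-tuples-∏1 k (boolFuns n) p total ⟩
      1ℚ ∎
  }
  where
  open IsDistribution dist using (nonNeg; total)
  open ≡-Reasoning

growth-isDistribution : ∀ {μ : BoolFun n → ℚ} (α : BoolFun k) → IsDistribution μ → ∀ i → IsDistribution (growth μ α i)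
growth-isDistribution α dist zero    = dist
growth-isDistribution α dist (suc i) = step-isDistribution α (growth-isDistribution α dist i)

∣E∣≤ : ∀ {p : BoolFun n → ℚ} → IsDistribution p → ∀ φ → ∣ E p φ ∣ ≤ E p (∣_∣ ∘ φ)
∣E∣≤ {n} {p} dist φ = ≤-trans (∣sum∣≤sum∣∣ (boolFuns n) (λ f → p f * φ f)) (≤-reflexive
  (sum-cong (boolFuns n) (λ f → trans (∣p*q∣≡∣p∣*∣q∣ (p f) (φ f)) (cong (_* ∣ φ f ∣) (0≤p⇒∣p∣≡p (IsDistribution.nonNeg dist f))))))

-- Moments

-- The product of the signs of a Boolean function at a list of points, each of
-- which is completed by a first coordinate true: one representative of each
-- pair of antipodal points.
charac : List (Vec Bool n) → BoolFun (suc n) → ℚ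
charac []      g = 1ℚ
charac (x ∷ S) g = sign (g (true ∷ x)) * charac S g

charac-ext : ∀ (S : List (Vec Bool n)) → Extensional (charac S)
charac-ext []      f≗g = refl
charac-ext (x ∷ S) f≗g = cong₂ (λ b y → sign b * y) (f≗g (true ∷ x)) (charac-ext S f≗g)

∣charac∣ : ∀ (S : List (Vec Bool n)) g → ∣ charac S g ∣ ≡ 1ℚ
∣charac∣ []      g = refl
∣charac∣ (x ∷ S) g = trans (∣sign*∣ (g (true ∷ x)) (charac S g)) (∣charac∣ S g)

charac-ʳ++ : ∀ (S U : List (Vec Bool n)) g → charac (S ʳ++ U) g ≡ charac S g * charac U g
charac-ʳ++ []      U g = sym (*-identityˡ (charac U g))
charac-ʳ++ (x ∷ S) U g = trans (charac-ʳ++ S (x ∷ U) g)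
  (solve 3 (λ s a b → a :* (s :* b) := (s :* a) :* b) refl (sign (g (true ∷ x))) (charac S g) (charac U g))

-- The Fourier coefficients of a distribution, restricted to the half cube.
moment : (BoolFun (suc n) → ℚ) → List (Vec Bool n) → ℚ
moment p S = E p (charac S)

∣moment∣≤1 : ∀ {p : BoolFun (suc n) → ℚ} → IsDistribution p → ∀ S → ∣ moment p S ∣ ≤ 1ℚ
∣moment∣≤1 {p = p} dist S = ≤-trans (∣E∣≤ dist (charac S))
  (≤-reflexive (trans (E-cong p (∣charac∣ S)) (E-1 dist)))

moment-[] : ∀ {p : BoolFun (suc n) → ℚ} → IsDistribution p → moment p [] ≡ 1ℚ
moment-[] = E-1

-- Adds the point x to the entries at the coordinates in T.
extend : Vec Bool k → Vec Bool n → Vec (List (Vec Bool n)) k → Vec (List (Vec Bool n)) k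
extend T x = zipWith (λ t S → if t then x ∷ S else S) T

-- Multiplying by the character of the values at x amounts to adding x.
χ-extend : ∀ (T : Vec Bool k) (x : Vec Bool n) Ss gs →
  χ T (Vec.map (λ g → g (true ∷ x)) gs) * ∏ (zipWith charac Ss gs) ≡ ∏ (zipWith charac (extend T x Ss) gs)
χ-extend []          x []       []       = *-identityˡ 1ℚ
χ-extend (false ∷ T) x (S ∷ Ss) (g ∷ gs) = trans
  (solve 3 (λ a b c → a :* (b :* c) := b :* (a :* c)) refl (χ T _) (charac S g) (∏ (zipWith charac Ss gs)))
  (cong (charac S g *_) (χ-extend T x Ss gs))
χ-extend (true ∷ T)  x (S ∷ Ss) (g ∷ gs) = begin
  sign (g (true ∷ x) xor dot T ys) * (charac S g * Q)    ≡⟨ cong (_* (charac S g * Q)) (sign-xor (g (true ∷ x)) (dot T ys)) ⟩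
  (sign (g (true ∷ x)) * χ T ys) * (charac S g * Q)      ≡⟨ solve 4 (λ s a b c → (s :* a) :* (b :* c) := (s :* b) :* (a :* c))
                                                              refl (sign (g (true ∷ x))) (χ T ys) (charac S g) Q ⟩
  charac (x ∷ S) g * (χ T ys * Q)                        ≡⟨ cong (charac (x ∷ S) g *_) (χ-extend T x Ss gs) ⟩
  charac (x ∷ S) g * ∏ (zipWith charac (extend T x Ss) gs) ∎
  where
  open ≡-Reasoning
  ys : Vec Bool _
  ys = Vec.map (λ g → g (true ∷ x)) gs
  Q : ℚ
  Q = ∏ (zipWith charac Ss gs)

-- The joint moment of the new function at the points S and of the old
-- functions g₁, ..., gₖ at the points of the entries of Us.
mixed : BoolFun k → (BoolFun (suc n) → ℚ) → List (Vec Bool n) → Vec (List (Vec Bool n)) k → ℚ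
mixed {k} {n} α p S Us =
  ∑[ gs ∈ tuples k (boolFuns (suc n)) ] ∏ (Vec.map p gs) * (charac S (compose α gs) * ∏ (zipWith charac Us gs))

mixed-[] : ∀ (α : BoolFun k) (p : BoolFun (suc n) → ℚ) Us → mixed α p [] Us ≡ ∏ (Vec.map (moment p) Us)
mixed-[] {k} {n} α p Us = trans
  (sum-cong (tuples k (boolFuns (suc n))) (λ gs → cong (∏ (Vec.map p gs) *_) (*-identityˡ (∏ (zipWith charac Us gs)))))
  (sum-tuples-∏ (boolFuns (suc n)) p charac Us)

-- Expanding one of the new values by Fourier inversion.
mixed-∷ : ∀ (α : BoolFun k) (p : BoolFun (suc n) → ℚ) x S Us →
  mixed α p (x ∷ S) Us ≡ ∑[ T ∈ cube k ] hat (sign ∘ α) T * mixed α p S (extend T x Us)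
mixed-∷ {k} {n} α p x S Us = begin
  ∑[ gs ∈ ts ] P gs * (charac (x ∷ S) (compose α gs) * Q Us gs)
    ≡⟨ sum-cong ts expand ⟩
  ∑[ gs ∈ ts ] ∑[ T ∈ cube k ] hat (sign ∘ α) T * (P gs * (charac S (compose α gs) * Q (extend T x Us) gs))
    ≡⟨ sum-swap ts (cube k) _ ⟩
  ∑[ T ∈ cube k ] ∑[ gs ∈ ts ] hat (sign ∘ α) T * (P gs * (charac S (compose α gs) * Q (extend T x Us) gs))
    ≡⟨ sum-cong (cube k) (λ T → sum-*ˡ ts (hat (sign ∘ α) T) _) ⟩
  ∑[ T ∈ cube k ] hat (sign ∘ α) T * mixed α p S (extend T x Us) ∎
  where
  open ≡-Reasoning
  ts : List (Vec (BoolFun (suc n)) k)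
  ts = tuples k (boolFuns (suc n))
  P : Vec (BoolFun (suc n)) k → ℚ
  P gs = ∏ (Vec.map p gs)
  Q : Vec (List (Vec Bool n)) k → Vec (BoolFun (suc n)) k → ℚ
  Q Us gs = ∏ (zipWith charac Us gs)
  expand : ∀ gs → P gs * (charac (x ∷ S) (compose α gs) * Q Us gs) ≡
    ∑[ T ∈ cube k ] hat (sign ∘ α) T * (P gs * (charac S (compose α gs) * Q (extend T x Us) gs))
  expand gs = begin
    P gs * ((sign (α ys) * cα) * Q Us gs)
      ≡⟨ solve 4 (λ p s c q → p :* ((s :* c) :* q) := s :* (p :* (c :* q))) refl (P gs) (sign (α ys)) cα (Q Us gs) ⟩
    sign (α ys) * (P gs * (cα * Q Us gs))
      ≡⟨ cong (_* (P gs * (cα * Q Us gs))) (fourier-inversion (sign ∘ α) ys) ⟩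
    (∑[ T ∈ cube k ] hat (sign ∘ α) T * χ T ys) * (P gs * (cα * Q Us gs))
      ≡⟨ sym (sum-*ʳ (cube k) (P gs * (cα * Q Us gs)) _) ⟩
    ∑[ T ∈ cube k ] (hat (sign ∘ α) T * χ T ys) * (P gs * (cα * Q Us gs))
      ≡⟨ sum-cong (cube k) (λ T → trans
           (solve 5 (λ a t p c q → (a :* t) :* (p :* (c :* q)) := a :* (p :* (c :* (t :* q))))
              refl (hat (sign ∘ α) T) (χ T ys) (P gs) cα (Q Us gs))
           (cong (λ v → hat (sign ∘ α) T * (P gs * (cα * v))) (χ-extend T x Us gs))) ⟩
    ∑[ T ∈ cube k ] hat (sign ∘ α) T * (P gs * (cα * Q (extend T x Us) gs)) ∎
    where
    ys : Vec Bool k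
    ys = Vec.map (λ g → g (true ∷ x)) gs
    cα : ℚ
    cα = charac S (compose α gs)

∏-charac-[] : ∀ (gs : Vec (BoolFun (suc n)) k) → ∏ (zipWith charac (Vec.replicate k []) gs) ≡ 1ℚ
∏-charac-[] []       = refl
∏-charac-[] (g ∷ gs) = trans (*-identityˡ _) (∏-charac-[] gs)

moment-step : ∀ (α : BoolFun k) (p : BoolFun (suc n) → ℚ) S →
  moment (step α p) S ≡ mixed α p S (Vec.replicate k [])
moment-step {k} {n} α p S = trans (E-step α p (charac-ext S))
  (sum-cong (tuples k (boolFuns (suc n))) (λ gs → cong (∏ (Vec.map p gs) *_)
    (sym (trans (cong (charac S (compose α gs) *_) (∏-charac-[] gs)) (*-identityʳ (charac S (compose α gs)))))))

-- One step bounds the moments by smaller moments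

Unique-shift : ∀ (U : List (Vec Bool n)) x S → Unique (U ++ x ∷ S) → Unique (x ∷ U ++ S)
Unique-shift U x S = Permutation.Unique-resp-↭ (setoid _) (↭⇒↭ₛ (shift x U S))

length-shift : ∀ (U : List A) x S → length (U ++ x ∷ S) ≡ suc (length (U ++ S))
length-shift U x S = ↭-length (shift x U S)

Unique-suffix : ∀ (U : List (Vec Bool n)) {S} → Unique (U ++ S) → Unique S
Unique-suffix []      u       = u
Unique-suffix (x ∷ U) (_ ∷ u) = Unique-suffix U u

-- Small m S U: whatever points of S are still added to U, the outcome is a
-- nonempty set of fewer than m points.
record Small (m : ℕ) (S U : List (Vec Bool n)) : Set where
  constructor small
  field
    nonempty : U ≢ []
    unique   : Unique (U ++ S)
    few      : length (U ++ S) ℕ.< m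

small-insert : ∀ {m x} {S U : List (Vec Bool n)} → Small m (x ∷ S) U → Small m S (x ∷ U)
small-insert {x = x} {S} {U} (small U≢[] u l) =
  small (λ ()) (Unique-shift U x S u) (subst (ℕ._< _) (length-shift U x S) l)

tail-Unique : ∀ {x} {S : List (Vec Bool n)} → Unique (x ∷ S) → Unique S
tail-Unique (_ ∷ u) = u

small-skip : ∀ {m x} {S U : List (Vec Bool n)} → Small m (x ∷ S) U → Small m S U
small-skip {x = x} {S} {U} (small U≢[] u l) = small U≢[] (tail-Unique (Unique-shift U x S u))
  (ℕ.<-trans (ℕ.n<1+n (length (U ++ S))) (subst (ℕ._< _) (length-shift U x S) l))

small-extend : ∀ {m x} {S : List (Vec Bool n)} (T : Vec Bool k) {Us} →
  Any (Small m (x ∷ S)) Us → Any (Small m S) (extend T x Us)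
small-extend (true  ∷ T) (here s)  = here (small-insert s)
small-extend (false ∷ T) (here s)  = here (small-skip s)
small-extend (t     ∷ T) (there s) = there (small-extend T s)

-- The set U at the coordinates in T, the empty set elsewhere.
onlyOn : Vec Bool k → List (Vec Bool n) → Vec (List (Vec Bool n)) k
onlyOn T U = Vec.map (λ t → if t then U else []) T

extend-onlyOn : ∀ (T : Vec Bool k) (x : Vec Bool n) U → extend T x (onlyOn T U) ≡ onlyOn T (x ∷ U)
extend-onlyOn []          x U = refl
extend-onlyOn (true  ∷ T) x U = cong ((x ∷ U) ∷_) (extend-onlyOn T x U)
extend-onlyOn (false ∷ T) x U = cong ([] ∷_) (extend-onlyOn T x U)

extend-[] : ∀ (T : Vec Bool k) (x : Vec Bool n) → extend T x (Vec.replicate k []) ≡ onlyOn T (x ∷ [])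
extend-[] []          x = refl
extend-[] (true  ∷ T) x = cong ((x ∷ []) ∷_) (extend-[] T x)
extend-[] (false ∷ T) x = cong ([] ∷_) (extend-[] T x)

-- Extending onlyOn T U along a different set T′ leaves a coordinate that
-- misses either the new point or the points of U.
small-extend-onlyOn : ∀ {m x} {S : List (Vec Bool n)} (T′ T : Vec Bool k) U → T′ ≢ T → U ≢ [] →
  Unique (U ++ x ∷ S) → length (U ++ x ∷ S) ℕ.≤ m → Any (Small m S) (extend T′ x (onlyOn T U))
small-extend-onlyOn []          []          U T′≢T _ _ _ = contradiction refl T′≢T
small-extend-onlyOn (true  ∷ T′) (true  ∷ T) U T′≢T U≢[] u l =
  there (small-extend-onlyOn T′ T U (T′≢T ∘ cong (true ∷_)) U≢[] u l)
small-extend-onlyOn (false ∷ T′) (false ∷ T) U T′≢T U≢[] u l =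
  there (small-extend-onlyOn T′ T U (T′≢T ∘ cong (false ∷_)) U≢[] u l)
small-extend-onlyOn {x = x} {S} (false ∷ T′) (true ∷ T) U T′≢T U≢[] u l =
  here (small U≢[] (tail-Unique (Unique-shift U x S u)) (subst (ℕ._≤ _) (length-shift U x S) l))
small-extend-onlyOn (true ∷ T′) (false ∷ T) []      T′≢T U≢[] u l = contradiction refl U≢[]
small-extend-onlyOn {x = x} {S} (true ∷ T′) (false ∷ T) U@(y ∷ V) T′≢T U≢[] u l =
  here (small (λ ()) (Unique-suffix U u) (ℕ.≤-trans (ℕ.s≤s xS≤) l))
  where
  xS≤ : length (x ∷ S) ℕ.≤ length (V ++ x ∷ S)
  xS≤ = ℕ.≤-trans (ℕ.m≤n+m _ (length V)) (ℕ.≤-reflexive (sym (length-++ V)))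

-- Each vector occurs exactly once in the enumeration of the cube.
sum-≟ : ∀ (T : Vec Bool k) (F : Vec Bool k → ℚ) →
  ∑[ T′ ∈ cube k ] (if does (≡-dec Bool._≟_ T′ T) then F T′ else 0ℚ) ≡ F T
sum-≟ []          F = +-identityʳ (F [])
sum-≟ {suc k} (true  ∷ T) F = trans (sum-cube (λ T′ → if does (≡-dec Bool._≟_ T′ (true ∷ T)) then F T′ else 0ℚ))
  (trans (cong₂ _+_ (sum-≟ T (F ∘ (true ∷_))) (sum-0 (cube k))) (+-identityʳ _))
sum-≟ {suc k} (false ∷ T) F = trans (sum-cube (λ T′ → if does (≡-dec Bool._≟_ T′ (false ∷ T)) then F T′ else 0ℚ))
  (trans (cong₂ _+_ (sum-0 (cube k)) (sum-≟ T (F ∘ (false ∷_)))) (+-identityˡ _))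

module Contraction {α : BoolFun k} (nonlinear : ¬ Linear α) (dual : SelfDual α) where
  open Coefficients nonlinear dual

  -- The spectral norm of α.
  Λ : ℚ
  Λ = ∑[ T ∈ cube k ] ∣ α̂ T ∣

  0≤Λ : 0ℚ ≤ Λ
  0≤Λ = sum-nonNeg (cube k) (0≤∣p∣ ∘ α̂)

  -- The constants of the error terms in diagonal-bound.
  K : ℕ → ℚ
  K zero    = 0ℚ
  K (suc s) = Λ * (Λ ^ s + K s)

  0≤K : ∀ s → 0ℚ ≤ K s
  0≤K zero    = ≤-refl
  0≤K (suc s) = 0≤* 0≤Λ (0≤+ (0≤^ s 0≤Λ) (0≤K s))

  -- Here ε bounds the absolute values of the moments of the nonempty sets of
  -- fewer than m points.
  module _ {n m : ℕ} {p : BoolFun (suc n) → ℚ} (dist : IsDistribution p) {ε : ℚ} (0≤ε : 0ℚ ≤ ε)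
    (few : ∀ U → U ≢ [] → Unique U → length U ℕ.< m → ∣ moment p U ∣ ≤ ε) where

    ∣mixed∣≤ : ∀ x S Us → ∣ mixed α p (x ∷ S) Us ∣ ≤ ∑[ T ∈ cube k ] ∣ α̂ T ∣ * ∣ mixed α p S (extend T x Us) ∣
    ∣mixed∣≤ x S Us = begin
      ∣ mixed α p (x ∷ S) Us ∣
        ≡⟨ cong ∣_∣ (mixed-∷ α p x S Us) ⟩
      ∣ ∑[ T ∈ cube k ] α̂ T * mixed α p S (extend T x Us) ∣
        ≤⟨ ∣sum∣≤sum∣∣ (cube k) _ ⟩
      ∑[ T ∈ cube k ] ∣ α̂ T * mixed α p S (extend T x Us) ∣
        ≡⟨ sum-cong (cube k) (λ T → ∣p*q∣≡∣p∣*∣q∣ (α̂ T) (mixed α p S (extend T x Us))) ⟩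
      ∑[ T ∈ cube k ] ∣ α̂ T ∣ * ∣ mixed α p S (extend T x Us) ∣ ∎
      where open ≤-Reasoning

    ∣∏moment∣≤1 : ∀ (Us : Vec (List (Vec Bool n)) k′) → ∣ ∏ (Vec.map (moment p) Us) ∣ ≤ 1ℚ
    ∣∏moment∣≤1 []       = ≤-refl
    ∣∏moment∣≤1 (U ∷ Us) = ≤-trans (≤-reflexive (∣p*q∣≡∣p∣*∣q∣ (moment p U) (∏ (Vec.map (moment p) Us))))
      (*-≤1 (0≤∣p∣ _) (∣moment∣≤1 dist U) (0≤∣p∣ _) (∣∏moment∣≤1 Us))

    ∣∏moment∣≤ε : ∀ {Us : Vec (List (Vec Bool n)) k′} → Any (Small m []) Us → ∣ ∏ (Vec.map (moment p) Us) ∣ ≤ ε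
    ∣∏moment∣≤ε {Us = U ∷ Us} (here (small U≢[] u l)) = begin
      ∣ moment p U * ∏ (Vec.map (moment p) Us) ∣      ≡⟨ ∣p*q∣≡∣p∣*∣q∣ (moment p U) (∏ (Vec.map (moment p) Us)) ⟩
      ∣ moment p U ∣ * ∣ ∏ (Vec.map (moment p) Us) ∣  ≤⟨ *-mono-≤ (0≤∣p∣ _) (few U U≢[] (subst Unique (++-identityʳ U) u)
                                                           (subst (λ V → length V ℕ.< m) (++-identityʳ U) l))
                                                           (0≤∣p∣ _) (∣∏moment∣≤1 Us) ⟩
      ε * 1ℚ                                          ≡⟨ *-identityʳ ε ⟩
      ε                                               ∎
      where open ≤-Reasoning
    ∣∏moment∣≤ε {Us = U ∷ Us} (there s) = begin
      ∣ moment p U * ∏ (Vec.map (moment p) Us) ∣      ≡⟨ ∣p*q∣≡∣p∣*∣q∣ (moment p U) (∏ (Vec.map (moment p) Us)) ⟩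
      ∣ moment p U ∣ * ∣ ∏ (Vec.map (moment p) Us) ∣  ≤⟨ *-mono-≤ (0≤∣p∣ _) (∣moment∣≤1 dist U) (0≤∣p∣ _) (∣∏moment∣≤ε s) ⟩
      1ℚ * ε                                          ≡⟨ *-identityˡ ε ⟩
      ε                                               ∎
      where open ≤-Reasoning

    -- One of the final sets is small, whatever sets of arguments are chosen at
    -- the points of S.
    off-diagonal-bound : ∀ S {Us} → Any (Small m S) Us → ∣ mixed α p S Us ∣ ≤ Λ ^ length S * ε
    off-diagonal-bound []      {Us} s = ≤-trans (≤-reflexive (cong ∣_∣ (mixed-[] α p Us)))
      (≤-trans (∣∏moment∣≤ε s) (≤-reflexive (sym (*-identityˡ ε))))
    off-diagonal-bound (x ∷ S) {Us} s = begin
      ∣ mixed α p (x ∷ S) Us ∣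
        ≤⟨ ∣mixed∣≤ x S Us ⟩
      ∑[ T ∈ cube k ] ∣ α̂ T ∣ * ∣ mixed α p S (extend T x Us) ∣
        ≤⟨ sum-mono (cube k) (λ T → *-monoˡ-≤ (0≤∣p∣ (α̂ T)) (off-diagonal-bound S (small-extend T s))) ⟩
      ∑[ T ∈ cube k ] ∣ α̂ T ∣ * (Λ ^ length S * ε)
        ≡⟨ sum-*ʳ (cube k) (Λ ^ length S * ε) (λ T → ∣ α̂ T ∣) ⟩
      Λ * (Λ ^ length S * ε)
        ≡⟨ sym (*-assoc Λ (Λ ^ length S) ε) ⟩
      Λ ^ length (x ∷ S) * ε ∎
      where open ≤-Reasoning

    ∣∏moment-onlyOn∣ : ∀ (T : Vec Bool k′) U → ∣ ∏ (Vec.map (moment p) (onlyOn T U)) ∣ ≡ ∣ moment p U ∣ ^ weight T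
    ∣∏moment-onlyOn∣ []          U = refl
    ∣∏moment-onlyOn∣ (true  ∷ T) U = trans (∣p*q∣≡∣p∣*∣q∣ (moment p U) _) (cong (∣ moment p U ∣ *_) (∣∏moment-onlyOn∣ T U))
    ∣∏moment-onlyOn∣ (false ∷ T) U = trans
      (cong ∣_∣ (trans (cong (_* ∏ (Vec.map (moment p) (onlyOn T U))) (moment-[] dist)) (*-identityˡ _)))
      (∣∏moment-onlyOn∣ T U)

    -- The set T has been chosen at all points so far, which make up U. Choosing
    -- T at the remaining points S too gives the main term; the first deviation
    -- from T leaves a small set.
    diagonal-bound : ∀ T S U → U ≢ [] → Unique (U ++ S) → length (U ++ S) ℕ.≤ m →
      ∣ mixed α p S (onlyOn T U) ∣ ≤ ∣ α̂ T ∣ ^ length S * ∣ moment p (S ʳ++ U) ∣ ^ weight T + K (length S) * ε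
    diagonal-bound T []      U U≢[] u l = ≤-reflexive (begin
      ∣ mixed α p [] (onlyOn T U) ∣                 ≡⟨ cong ∣_∣ (mixed-[] α p (onlyOn T U)) ⟩
      ∣ ∏ (Vec.map (moment p) (onlyOn T U)) ∣       ≡⟨ ∣∏moment-onlyOn∣ T U ⟩
      ∣ moment p U ∣ ^ weight T                       ≡⟨ solve 2 (λ x e → x := con 1ℚ :* x :+ con 0ℚ :* e) refl (∣ moment p U ∣ ^ weight T) ε ⟩
      1ℚ * ∣ moment p U ∣ ^ weight T + 0ℚ * ε         ∎)
      where open ≡-Reasoning
    diagonal-bound T (x ∷ S) U U≢[] u l = begin
      ∣ mixed α p (x ∷ S) (onlyOn T U) ∣
        ≤⟨ ∣mixed∣≤ x S (onlyOn T U) ⟩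
      ∑[ T′ ∈ cube k ] ∣ α̂ T′ ∣ * ∣ mixed α p S (extend T′ x (onlyOn T U)) ∣
        ≤⟨ sum-mono (cube k) term ⟩
      ∑[ T′ ∈ cube k ] ((if does (≡-dec Bool._≟_ T′ T) then ∣ α̂ T′ ∣ * main else 0ℚ) + ∣ α̂ T′ ∣ * error)
        ≡⟨ sum-+ (cube k) _ _ ⟩
      ∑[ T′ ∈ cube k ] (if does (≡-dec Bool._≟_ T′ T) then ∣ α̂ T′ ∣ * main else 0ℚ) + ∑[ T′ ∈ cube k ] ∣ α̂ T′ ∣ * error
        ≡⟨ cong₂ _+_ (sum-≟ T (λ T′ → ∣ α̂ T′ ∣ * main)) (sum-*ʳ (cube k) error (λ T′ → ∣ α̂ T′ ∣)) ⟩
      ∣ α̂ T ∣ * main + Λ * error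
        ≡⟨ solve 6 (λ a b c l t e → a :* (b :* c) :+ l :* (t :* e) := (a :* b) :* c :+ (l :* t) :* e)
             refl ∣ α̂ T ∣ (∣ α̂ T ∣ ^ s) (a ^ weight T) Λ (Λ ^ s + K s) ε ⟩
      ∣ α̂ T ∣ ^ suc s * a ^ weight T + K (suc s) * ε ∎
      where
      open ≤-Reasoning
      s : ℕ
      s = length S
      a main error : ℚ
      a     = ∣ moment p (S ʳ++ (x ∷ U)) ∣
      main  = ∣ α̂ T ∣ ^ s * a ^ weight T
      error = (Λ ^ s + K s) * ε
      Λ≤ : Λ ^ s * ε ≤ error
      Λ≤ = *-monoʳ-≤ 0≤ε (≤-trans (≤-reflexive (sym (+-identityʳ (Λ ^ s)))) (+-monoʳ-≤ (Λ ^ s) (0≤K s)))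
      K≤ : K s * ε ≤ error
      K≤ = *-monoʳ-≤ 0≤ε (≤-trans (≤-reflexive (sym (+-identityˡ (K s)))) (+-monoˡ-≤ (K s) (0≤^ s 0≤Λ)))
      term : ∀ T′ → ∣ α̂ T′ ∣ * ∣ mixed α p S (extend T′ x (onlyOn T U)) ∣ ≤
                    (if does (≡-dec Bool._≟_ T′ T) then ∣ α̂ T′ ∣ * main else 0ℚ) + ∣ α̂ T′ ∣ * error
      term T′ with ≡-dec Bool._≟_ T′ T
      ... | yes refl = ≤-trans
        (*-monoˡ-≤ (0≤∣p∣ (α̂ T)) (≤-trans
          (≤-trans (≤-reflexive (cong (λ Us → ∣ mixed α p S Us ∣) (extend-onlyOn T x U)))
                   (diagonal-bound T S (x ∷ U) (λ ()) (Unique-shift U x S u) (subst (ℕ._≤ m) (length-shift U x S) l)))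
          (+-monoʳ-≤ main K≤)))
        (≤-reflexive (*-distribˡ-+ ∣ α̂ T ∣ main error))
      ... | no T′≢T = ≤-trans
        (*-monoˡ-≤ (0≤∣p∣ (α̂ T′)) (≤-trans (off-diagonal-bound S (small-extend-onlyOn T′ T U T′≢T U≢[] u l)) Λ≤))
        (≤-reflexive (sym (+-identityˡ (∣ α̂ T′ ∣ * error))))

    moment-step-bound : ∀ x S → Unique (x ∷ S) → length (x ∷ S) ℕ.≤ m →
      ∣ moment (step α p) (x ∷ S) ∣ ≤ diagonal (length (x ∷ S)) ∣ moment p (x ∷ S) ∣ + (Λ * K (length S)) * ε
    moment-step-bound x S u l = begin
      ∣ moment (step α p) (x ∷ S) ∣
        ≡⟨ cong ∣_∣ (moment-step α p (x ∷ S)) ⟩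
      ∣ mixed α p (x ∷ S) (Vec.replicate k []) ∣
        ≤⟨ ∣mixed∣≤ x S (Vec.replicate k []) ⟩
      ∑[ T ∈ cube k ] ∣ α̂ T ∣ * ∣ mixed α p S (extend T x (Vec.replicate k [])) ∣
        ≤⟨ sum-mono (cube k) (λ T → *-monoˡ-≤ (0≤∣p∣ (α̂ T)) (begin
             ∣ mixed α p S (extend T x (Vec.replicate k [])) ∣
               ≡⟨ cong (λ Us → ∣ mixed α p S Us ∣) (extend-[] T x) ⟩
             ∣ mixed α p S (onlyOn T (x ∷ [])) ∣
               ≤⟨ diagonal-bound T S (x ∷ []) (λ ()) u l ⟩
             ∣ α̂ T ∣ ^ s * ∣ moment p (S ʳ++ (x ∷ [])) ∣ ^ weight T + K s * ε
               ≡⟨ cong (λ y → ∣ α̂ T ∣ ^ s * ∣ y ∣ ^ weight T + K s * ε) reorder ⟩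
             ∣ α̂ T ∣ ^ s * a ^ weight T + K s * ε ∎)) ⟩
      ∑[ T ∈ cube k ] ∣ α̂ T ∣ * (∣ α̂ T ∣ ^ s * a ^ weight T + K s * ε)
        ≡⟨ sum-cong (cube k) (λ T → solve 4 (λ a b c e → a :* (b :* c :+ e) := (a :* b) :* c :+ a :* e)
             refl ∣ α̂ T ∣ (∣ α̂ T ∣ ^ s) (a ^ weight T) (K s * ε)) ⟩
      ∑[ T ∈ cube k ] (∣ α̂ T ∣ ^ suc s * a ^ weight T + ∣ α̂ T ∣ * (K s * ε))
        ≡⟨ sum-+ (cube k) _ _ ⟩
      diagonal (suc s) a + ∑[ T ∈ cube k ] ∣ α̂ T ∣ * (K s * ε)
        ≡⟨ cong (_+_ (diagonal (suc s) a)) (trans (sum-*ʳ (cube k) (K s * ε) (λ T → ∣ α̂ T ∣)) (sym (*-assoc Λ (K s) ε))) ⟩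
      diagonal (suc s) a + (Λ * K s) * ε ∎
      where
      open ≤-Reasoning
      s : ℕ
      s = length S
      a : ℚ
      a = ∣ moment p (x ∷ S) ∣
      reorder : moment p (S ʳ++ (x ∷ [])) ≡ moment p (x ∷ S)
      reorder = E-cong p (λ g → trans (charac-ʳ++ S (x ∷ []) g)
        (solve 2 (λ c s → c :* (s :* con 1ℚ) := s :* c) refl (charac S g) (sign (g (true ∷ x)))))

-- Moments of the initial distribution

-- A function bounded by 1 loses at least the mass of any point at which it is
-- not positive.
E-gap : ∀ {p : BoolFun n → ℚ} → IsDistribution p → ∀ φ → (∀ f → φ f ≤ 1ℚ) →
  ∀ h → (∀ f → h ≗ f → φ f ≤ 0ℚ) → E p φ ≤ 1ℚ - p h
E-gap {n} {p} dist φ φ≤1 h φh≤0 = begin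
  E p φ
    ≤⟨ sum-mono (boolFuns n) bound ⟩
  ∑[ f ∈ boolFuns n ] (p f - (if does (h ≗? f) then p f else 0ℚ))
    ≡⟨ sum-- (boolFuns n) p _ ⟩
  sum (boolFuns n) p - ∑[ f ∈ boolFuns n ] (if does (h ≗? f) then p f else 0ℚ)
    ≡⟨ cong₂ _-_ (IsDistribution.total dist) (sum-≗? (IsDistribution.cong dist) h) ⟩
  1ℚ - p h ∎
  where
  open ≤-Reasoning
  bound : ∀ f → p f * φ f ≤ p f - (if does (h ≗? f) then p f else 0ℚ)
  bound f with h ≗? f
  ... | yes h≗f = ≤-trans (*-monoˡ-≤ (IsDistribution.nonNeg dist f) (φh≤0 f h≗f))
                    (≤-reflexive (solve 1 (λ x → x :* con 0ℚ := x :- x) refl (p f)))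
  ... | no  _   = ≤-trans (*-monoˡ-≤ (IsDistribution.nonNeg dist f) (φ≤1 f))
                    (≤-reflexive (solve 1 (λ x → x :* con 1ℚ := x :- con 0ℚ) refl (p f)))

≢⇒lookup≢ : ∀ (x y : Vec Bool n) → x ≢ y → ∃ λ j → lookup x j ≢ lookup y j
≢⇒lookup≢ []      []      x≢y = contradiction refl x≢y
≢⇒lookup≢ (a ∷ x) (b ∷ y) x≢y with a Bool.≟ b
... | no  a≢b  = zero , a≢b
... | yes refl with ≢⇒lookup≢ x y (x≢y ∘ cong (a ∷_))
...   | j , d = suc j , d

sign-≢ : ∀ a b → a ≢ b → sign a * (sign b * 1ℚ) ≡ - 1ℚ
sign-≢ true  true  a≢b = contradiction refl a≢b
sign-≢ true  false a≢b = refl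
sign-≢ false true  a≢b = refl
sign-≢ false false a≢b = contradiction refl a≢b

module Initial {μ : BoolFun (suc n) → ℚ} (uniform : IsUniformOver Literal μ) where
  open IsUniformOver uniform

  μ-complement : ∀ f → μ (not ∘ f) ≡ μ f
  μ-complement f with μ f ≟ 0ℚ | μ (not ∘ f) ≟ 0ℚ
  ... | yes eq | yes eq′ = trans eq′ (sym eq)
  ... | no ≢0  | _       = constant (not ∘ f) f (complement (Equivalence.to (support f) ≢0)) (Equivalence.to (support f) ≢0)
    where
    complement : ∀ {f} → Literal f → Literal (not ∘ f)
    complement (j , inj₁ e) = j , inj₂ (cong not ∘ e)
    complement (j , inj₂ e) = j , inj₁ (λ x → trans (cong not (e x)) (Bool.not-involutive _))
  ... | yes _  | no ≢0   = constant (not ∘ f) f (Equivalence.to (support (not ∘ f)) ≢0)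
                             (complement⁻ (Equivalence.to (support (not ∘ f)) ≢0))
    where
    complement⁻ : Literal (not ∘ f) → Literal f
    complement⁻ (j , inj₁ e) = j , inj₂ (λ x → trans (sym (Bool.not-involutive (f x))) (cong not (e x)))
    complement⁻ (j , inj₂ e) = j , inj₁ (λ x → Bool.not-injective (e x))

  moment-singleton : ∀ x → moment μ (x ∷ []) ≡ 0ℚ
  moment-singleton x = ≡-⇒≡0 (begin
    ∑[ f ∈ boolFuns (suc n) ] μ f * charac (x ∷ []) f
      ≡⟨ sym (sum-complement {φ = λ f → μ f * charac (x ∷ []) f}
           (λ f≗g → cong₂ _*_ (IsDistribution.cong isDistribution f≗g) (charac-ext (x ∷ []) f≗g))) ⟩
    ∑[ f ∈ boolFuns (suc n) ] μ (not ∘ f) * charac (x ∷ []) (not ∘ f)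
      ≡⟨ sum-cong (boolFuns (suc n)) (λ f → trans
           (cong₂ (λ a b → a * (b * 1ℚ)) (μ-complement f) (sign-not (f (true ∷ x))))
           (solve 2 (λ m s → m :* ((:- s) :* con 1ℚ) := :- (m :* (s :* con 1ℚ))) refl (μ f) (sign (f (true ∷ x))))) ⟩
    ∑[ f ∈ boolFuns (suc n) ] (- (μ f * charac (x ∷ []) f))
      ≡⟨ sum-neg (boolFuns (suc n)) _ ⟩
    - moment μ (x ∷ []) ∎)
    where open ≡-Reasoning

  -- One minus the common mass of the literals.
  bias : ℚ
  bias = 1ℚ - μ (projection zero)

  bias<1 : bias < 1ℚ
  bias<1 = <-≤-trans (+-monoʳ-< 1ℚ (neg-antimono-< 0<μ)) (≤-reflexive (+-identityʳ 1ℚ))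
    where
    0<μ : 0ℚ < μ (projection zero)
    0<μ = <-≤-trans (≢0⇒0<∣∣ (Equivalence.from (support (projection zero)) (zero , inj₁ (λ _ → refl))))
            (≤-reflexive (0≤p⇒∣p∣≡p (IsDistribution.nonNeg isDistribution _)))

  -- The projection to the first coordinate agrees at two points of the half
  -- cube, the projection to a coordinate separating them does not.
  ∣moment-pair∣ : ∀ x y → x ≢ y → ∣ moment μ (x ∷ y ∷ []) ∣ ≤ bias
  ∣moment-pair∣ x y x≢y = ∣∣≤ upper lower
    where
    S : List (Vec Bool n)
    S = x ∷ y ∷ []
    j : Fin n
    j = proj₁ (≢⇒lookup≢ x y x≢y)
    upper : moment μ S ≤ bias
    upper = ≤-trans
      (E-gap isDistribution (charac S) (λ f → ≤-trans (p≤∣p∣ _) (≤-reflexive (∣charac∣ S f))) (projection (suc j))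
        (λ f e → ≤-trans (≤-reflexive (trans (sym (charac-ext S e)) (sign-≢ _ _ (proj₂ (≢⇒lookup≢ x y x≢y)))))
                         (toWitness {a? = - 1ℚ ≤? 0ℚ} _)))
      (≤-reflexive (cong (λ y → 1ℚ - y) (constant _ _ (suc j , inj₁ (λ _ → refl)) (zero , inj₁ (λ _ → refl)))))
    lower : - moment μ S ≤ bias
    lower = ≤-trans
      (≤-reflexive (trans (sym (sum-neg (boolFuns (suc n)) (λ f → μ f * charac S f)))
        (sum-cong (boolFuns (suc n)) (λ f → neg-distribʳ-* (μ f) (charac S f)))))
      (E-gap isDistribution (-_ ∘ charac S)
        (λ f → ≤-trans (p≤∣p∣ _) (≤-reflexive (trans (∣-p∣≡∣p∣ (charac S f)) (∣charac∣ S f)))) (projection zero)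
        (λ f e → ≤-trans (≤-reflexive (cong -_ (sym (charac-ext S e)))) (toWitness {a? = - 1ℚ ≤? 0ℚ} _)))

-- Decay of the moments

-- A sequence bounded by 1 that contracts up to an error (1 - c) * η drops by
-- at least that amount in each step until it is at most 2η, and stays there.
module Contracting {c η : ℚ} (0≤c : 0ℚ ≤ c) (c<1 : c < 1ℚ) (0<η : 0ℚ < η) where

  private
    κ : ℚ
    κ = (1ℚ - c) * η

    0<κ : 0ℚ < κ
    0<κ = 0<* (<⇒0<- c<1) 0<η

    2η : ℚ
    2η = η + η

    drop : ∀ a → η + η ≤ a → c * a + κ ≤ a - κ
    drop a 2η≤a = begin
      c * a + κ                                 ≡⟨ solve 3 (λ c a h → c :* a :+ (con 1ℚ :- c) :* h :=
                                                       a :- (con 1ℚ :- c) :* (a :- h)) refl c a η ⟩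
      a - (1ℚ - c) * (a - η)                    ≤⟨ +-monoʳ-≤ a (neg-antimono-≤ (*-monoˡ-≤ (<⇒≤ (<⇒0<- c<1)) η≤a-η)) ⟩
      a - κ                                     ∎
      where
      open ≤-Reasoning
      η≤a-η : η ≤ a - η
      η≤a-η = ≤-trans (≤-reflexive (solve 1 (λ h → h := (h :+ h) :- h) refl η)) (+-monoˡ-≤ (- η) 2η≤a)

    stay : ∀ a → a ≤ 2η → c * a + κ ≤ 2η
    stay a a≤2η = begin
      c * a + κ        ≤⟨ +-monoˡ-≤ κ (*-monoˡ-≤ 0≤c a≤2η) ⟩
      c * 2η + κ       ≤⟨ drop 2η ≤-refl ⟩
      2η - κ           ≤⟨ +-monoʳ-≤ 2η (neg-antimono-≤ (<⇒≤ 0<κ)) ⟩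
      2η + 0ℚ          ≡⟨ +-identityʳ 2η ⟩
      2η               ∎
      where open ≤-Reasoning

  -- The number of steps does not depend on the sequence, which makes the decay
  -- uniform.
  steps : ℕ
  steps = proj₁ (archimedean κ 0<κ)

  contracting⇒small : ∀ (a : ℕ → ℚ) N → (∀ i → a i ≤ 1ℚ) →
    (∀ i → i ℕ.≥ N → a (suc i) ≤ c * a i + (1ℚ - c) * η) →
    ∀ i → i ℕ.≥ steps ℕ.+ N → a i ≤ η + η
  contracting⇒small a N a≤1 contract i i≥ = subst (λ j → a j ≤ 2η) (ℕ.m∸n+n≡m i≥) (after (i ℕ.∸ (steps ℕ.+ N)))
    where
    progress : ∀ t → a (t ℕ.+ N) ≤ 2η ⊎ a (t ℕ.+ N) ≤ 1ℚ - t copies κ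
    progress zero = inj₂ (≤-trans (a≤1 N) (≤-reflexive (sym (+-identityʳ 1ℚ))))
    progress (suc t) with a (t ℕ.+ N) ≤? 2η | progress t
    ... | yes a≤ | _       = inj₁ (≤-trans (contract _ (ℕ.m≤n+m N t)) (stay _ a≤))
    ... | no  a≰ | inj₁ a≤ = contradiction a≤ a≰
    ... | no  a≰ | inj₂ a≤ = inj₂ (begin
      a (suc t ℕ.+ N)             ≤⟨ contract _ (ℕ.m≤n+m N t) ⟩
      c * a (t ℕ.+ N) + κ         ≤⟨ drop _ (<⇒≤ (≰⇒> a≰)) ⟩
      a (t ℕ.+ N) - κ             ≤⟨ +-monoˡ-≤ (- κ) a≤ ⟩
      (1ℚ - t copies κ) - κ       ≡⟨ solve 2 (λ t k → (con 1ℚ :- t) :- k := con 1ℚ :- (k :+ t)) refl (t copies κ) κ ⟩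
      1ℚ - suc t copies κ         ∎)
      where open ≤-Reasoning
    0≤2η : 0ℚ ≤ 2η
    0≤2η = 0≤+ (<⇒≤ 0<η) (<⇒≤ 0<η)
    after : ∀ s → a (s ℕ.+ (steps ℕ.+ N)) ≤ 2η
    after zero with progress steps
    ... | inj₁ a≤ = a≤
    ... | inj₂ a≤ = ≤-trans a≤ (≤-trans
      (+-monoʳ-≤ 1ℚ (neg-antimono-≤ (proj₂ (archimedean κ 0<κ))))
      (≤-trans (≤-reflexive (+-inverseʳ 1ℚ)) 0≤2η))
    after (suc s) = ≤-trans
      (contract _ (ℕ.≤-trans (ℕ.m≤n+m N steps) (ℕ.m≤n+m (steps ℕ.+ N) s)))
      (stay _ (after s))

module Decay {α : BoolFun k} (nonlinear : ¬ Linear α) (dual : SelfDual α)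
             {μ : BoolFun (suc n) → ℚ} (uniform : IsUniformOver Literal μ) where
  open Coefficients nonlinear dual
  open Contraction nonlinear dual
  open Initial uniform

  M : ℕ → List (Vec Bool n) → ℚ
  M i = moment (growth μ α i)

  dist : ∀ i → IsDistribution (growth μ α i)
  dist = growth-isDistribution α (IsUniformOver.isDistribution uniform)

  ∣M∣≤1 : ∀ S i → ∣ M i S ∣ ≤ 1ℚ
  ∣M∣≤1 S i = ∣moment∣≤1 (dist i) S

  -- There are no smaller nonempty sets, and the diagonal part has no constant
  -- term.
  M-singleton : ∀ i x → M i (x ∷ []) ≡ 0ℚ
  M-singleton zero    x = moment-singleton x
  M-singleton (suc i) x = ∣p∣≡0⇒p≡0 _ (≤-antisym (begin
    ∣ M (suc i) (x ∷ []) ∣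
      ≤⟨ moment-step-bound {m = 1} (dist i) ≤-refl few x [] ([] ∷ []) ℕ.≤-refl ⟩
    diagonal 1 ∣ M i (x ∷ []) ∣ + (Λ * K 0) * 0ℚ
      ≡⟨ cong₂ _+_ (trans (cong (diagonal 1 ∘ ∣_∣) (M-singleton i x)) (diagonal-zero 0)) (*-zeroʳ (Λ * K 0)) ⟩
    0ℚ ∎) (0≤∣p∣ (M (suc i) (x ∷ []))))
    where
    open ≤-Reasoning
    few : ∀ U → U ≢ [] → Unique U → length U ℕ.< 1 → ∣ M i U ∣ ≤ 0ℚ
    few []      U≢[] _ _            = contradiction refl U≢[]
    few (_ ∷ _) _    _ (ℕ.s≤s ())

  M-small : ∀ i U → U ≢ [] → Unique U → length U ℕ.≤ 1 → ∣ M i U ∣ ≤ 0ℚ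
  M-small i []          U≢[] _ _ = contradiction refl U≢[]
  M-small i (x ∷ [])    _    _ _ = ≤-reflexive (cong ∣_∣ (M-singleton i x))
  M-small i (_ ∷ _ ∷ _) _    _ (ℕ.s≤s ())

  ∣M-pair∣ : ∀ i x y → x ≢ y → ∣ M i (x ∷ y ∷ []) ∣ ≤ bias
  ∣M-pair∣ zero    x y x≢y = ∣moment-pair∣ x y x≢y
  ∣M-pair∣ (suc i) x y x≢y = begin
    ∣ M (suc i) S ∣
      ≤⟨ moment-step-bound {m = 2} (dist i) ≤-refl (λ U U≢[] u l → M-small i U U≢[] u (ℕ.s≤s⁻¹ l))
           x (y ∷ []) ((x≢y ∷ []) ∷ [] ∷ []) ℕ.≤-refl ⟩
    diagonal 2 ∣ M i S ∣ + (Λ * K 1) * 0ℚ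
      ≡⟨ trans (cong (_+_ (diagonal 2 ∣ M i S ∣)) (*-zeroʳ (Λ * K 1))) (+-identityʳ _) ⟩
    diagonal 2 ∣ M i S ∣
      ≤⟨ diagonal-2 (0≤∣p∣ (M i S)) (∣M-pair∣ i x y x≢y) bias<1 ⟩
    rate₂ bias * ∣ M i S ∣
      ≤⟨ *-monoʳ-≤ (0≤∣p∣ (M i S)) (<⇒≤ (rate₂<1 bias<1)) ⟩
    1ℚ * ∣ M i S ∣
      ≡⟨ *-identityˡ ∣ M i S ∣ ⟩
    ∣ M i S ∣
      ≤⟨ ∣M-pair∣ i x y x≢y ⟩
    bias ∎
    where
    open ≤-Reasoning
    S : List (Vec Bool n)
    S = x ∷ y ∷ []

  -- The moments of the nonempty sets of at most m points tend to 0, uniformly.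
  Decays : ℕ → Set
  Decays m = ∀ ε → 0ℚ < ε → ∃ λ N → ∀ i → i ℕ.≥ N →
    ∀ S → S ≢ [] → Unique S → length S ℕ.≤ m → ∣ M i S ∣ ≤ ε

  decays-suc : ∀ m → Decays m → ∀ c → c < 1ℚ → 0ℚ ≤ c →
    (∀ i S → Unique S → length S ≡ suc m → diagonal (suc m) ∣ M i S ∣ ≤ c * ∣ M i S ∣) →
    Decays (suc m)
  decays-suc m decays c c<1 0≤c contract ε 0<ε = N , bound
    where
    η : ℚ
    η = ½ * ε
    0<η : 0ℚ < η
    0<η = 0<* 0<½ 0<ε
    open Contracting 0≤c c<1 0<η
    scaled : ∃ λ δ → 0ℚ < δ × (Λ * K m) * δ ≤ (1ℚ - c) * η
    scaled = scale-down (Λ * K m) (0≤* 0≤Λ (0≤K m)) ((1ℚ - c) * η) (0<* (<⇒0<- c<1) 0<η)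
    δ : ℚ
    δ = proj₁ scaled
    N₀ N₁ N : ℕ
    N₀ = proj₁ (decays δ (proj₁ (proj₂ scaled)))
    N₁ = proj₁ (decays ε 0<ε)
    N  = (steps ℕ.+ N₀) ℕ.⊔ N₁
    step-≤ : ∀ x S → Unique (x ∷ S) → length S ≡ m → ∀ i → i ℕ.≥ N₀ →
      ∣ M (suc i) (x ∷ S) ∣ ≤ c * ∣ M i (x ∷ S) ∣ + (1ℚ - c) * η
    step-≤ x S u refl i i≥N₀ = ≤-trans
      (moment-step-bound {m = suc m} (dist i) (<⇒≤ (proj₁ (proj₂ scaled)))
        (λ U U≢[] u l → proj₂ (decays δ (proj₁ (proj₂ scaled))) i i≥N₀ U U≢[] u (ℕ.s≤s⁻¹ l)) x S u ℕ.≤-refl)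
      (+-mono-≤ (contract i (x ∷ S) u refl) (proj₂ (proj₂ scaled)))
    bound : ∀ i → i ℕ.≥ N → ∀ S → S ≢ [] → Unique S → length S ℕ.≤ suc m → ∣ M i S ∣ ≤ ε
    bound i i≥N []      S≢[] u l = contradiction refl S≢[]
    bound i i≥N (x ∷ S) S≢[] u l with length S ℕ.≟ m
    ... | no  ≢m = proj₂ (decays ε 0<ε) i (ℕ.≤-trans (ℕ.m≤n⊔m (steps ℕ.+ N₀) N₁) i≥N) (x ∷ S) S≢[] u
                     (ℕ.≤∧≢⇒< (ℕ.s≤s⁻¹ l) ≢m)
    ... | yes ≡m = ≤-trans
      (contracting⇒small (λ i → ∣ M i (x ∷ S) ∣) N₀ (∣M∣≤1 (x ∷ S)) (step-≤ x S u ≡m)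
        i (ℕ.≤-trans (ℕ.m≤m⊔n (steps ℕ.+ N₀) N₁) i≥N))
      (≤-reflexive (solve 1 (λ e → con ½ :* e :+ con ½ :* e := e) refl ε))

  decays : ∀ m → Decays m
  decays 0 ε 0<ε = 0 , λ i _ → λ { [] S≢[] _ _ → contradiction refl S≢[] }
  decays 1 ε 0<ε = 0 , λ i _ S S≢[] u l → ≤-trans (M-small i S S≢[] u l) (<⇒≤ 0<ε)
  decays 2 = decays-suc 1 (decays 1) c (rate₂<1 b<1) 0≤c pair
    where
    -- The maximum makes it evident that the rate is nonnegative.
    b : ℚ
    b = bias ℚ.⊔ 0ℚ
    b<1 : b < 1ℚ
    b<1 = [ (λ eq → ≤-<-trans (≤-reflexive eq) bias<1) , (λ eq → ≤-<-trans (≤-reflexive eq) 0<1) ]′ (⊔-sel bias 0ℚ)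
    c : ℚ
    c = rate₂ b
    0≤c : 0ℚ ≤ c
    0≤c = sum-nonNeg (cube k) (λ T → 0≤* (0≤square T) (0≤ρ (weight T)))
      where
      0≤ρ : ∀ w → 0ℚ ≤ ρ b w
      0≤ρ 0             = 0≤1
      0≤ρ 1             = 0≤1
      0≤ρ (suc (suc w)) = p≤q⊔p bias 0ℚ
    pair : ∀ i S → Unique S → length S ≡ 2 → diagonal 2 ∣ M i S ∣ ≤ c * ∣ M i S ∣
    pair i (x ∷ y ∷ []) ((x≢y ∷ []) ∷ _) refl =
      diagonal-2 (0≤∣p∣ (M i (x ∷ y ∷ []))) (≤-trans (∣M-pair∣ i x y x≢y) (p≤p⊔q bias 0ℚ)) b<1
  decays (suc m′@(suc (suc m))) = decays-suc m′ (decays m′) rate₃ rate₃<1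
    (sum-nonNeg (cube k) (λ T → 0≤^ 3 (0≤∣p∣ (α̂ T))))
    (λ i S _ _ → diagonal-≥3 m (0≤∣p∣ (M i S)) (∣M∣≤1 S i))

-- Only self-dual functions grow

selfDual? : (f : BoolFun n) → Dec (SelfDual f)
selfDual? f = f ≗? (λ y → not (f (Vec.map not y)))

literal-selfDual : ∀ {f : BoolFun n} → Literal f → SelfDual f
literal-selfDual {f = f} (j , inj₁ e) y = begin
  f y                              ≡⟨ e y ⟩
  lookup y j                       ≡⟨ sym (Bool.not-involutive _) ⟩
  not (not (lookup y j))           ≡⟨ cong not (sym (lookup-map j not y)) ⟩
  not (lookup (Vec.map not y) j)   ≡⟨ cong not (sym (e (Vec.map not y))) ⟩
  not (f (Vec.map not y))          ∎
  where open ≡-Reasoning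
literal-selfDual {f = f} (j , inj₂ e) y = begin
  f y                                    ≡⟨ e y ⟩
  not (lookup y j)                       ≡⟨ sym (lookup-map j not y) ⟩
  lookup (Vec.map not y) j               ≡⟨ sym (Bool.not-involutive _) ⟩
  not (not (lookup (Vec.map not y) j))   ≡⟨ cong not (sym (e (Vec.map not y))) ⟩
  not (f (Vec.map not y))                ∎
  where open ≡-Reasoning

compose-selfDual : ∀ {α : BoolFun k} → SelfDual α → ∀ {gs : Vec (BoolFun n) k} →
  All SelfDual gs → SelfDual (compose α gs)
compose-selfDual {α = α} dual duals y = trans (dual _) (cong (not ∘ α) (reflect duals))
  where
  reflect : ∀ {k} {gs : Vec (BoolFun _) k} → All SelfDual gs →
    Vec.map not (Vec.map (λ g → g y) gs) ≡ Vec.map (λ g → g (Vec.map not y)) gs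
  reflect []       = refl
  reflect (d ∷ ds) = cong₂ _∷_ (trans (cong not (d y)) (Bool.not-involutive _)) (reflect ds)

-- The mass is concentrated on the self-dual functions.
OnSelfDual : (BoolFun n → ℚ) → Set
OnSelfDual p = ∀ f → p f ≡ 0ℚ ⊎ SelfDual f

∏≡0⊎selfDual : ∀ {p : BoolFun n → ℚ} → OnSelfDual p → (gs : Vec (BoolFun n) k) →
  ∏ (Vec.map p gs) ≡ 0ℚ ⊎ All SelfDual gs
∏≡0⊎selfDual on []       = inj₂ []
∏≡0⊎selfDual {p = p} on (g ∷ gs) with on g | ∏≡0⊎selfDual on gs
... | inj₁ eq | _       = inj₁ (trans (cong (_* ∏ (Vec.map p gs)) eq) (*-zeroˡ (∏ (Vec.map p gs))))
... | inj₂ _  | inj₁ eq = inj₁ (trans (cong (p g *_) eq) (*-zeroʳ (p g)))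
... | inj₂ d  | inj₂ ds = inj₂ (d ∷ ds)

step-onSelfDual : ∀ {α : BoolFun k} → SelfDual α → {p : BoolFun n → ℚ} → OnSelfDual p → OnSelfDual (step α p)
step-onSelfDual {k} {n} {α} dual {p} on f with selfDual? f
... | yes d = inj₂ d
... | no ¬d = inj₁ (trans (step-if α p f) (trans (sum-cong (tuples k (boolFuns n)) vanish) (sum-0 (tuples k (boolFuns n)))))
  where
  vanish : ∀ gs → (if does (compose α gs ≗? f) then ∏ (Vec.map p gs) else 0ℚ) ≡ 0ℚ
  vanish gs with compose α gs ≗? f | ∏≡0⊎selfDual on gs
  ... | no _  | _       = refl
  ... | yes _ | inj₁ eq = eq
  ... | yes e | inj₂ ds = contradiction
    (λ y → trans (sym (e y)) (trans (compose-selfDual dual ds y) (cong not (e (Vec.map not y))))) ¬d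

growth-onSelfDual : ∀ {α : BoolFun k} → SelfDual α → {μ : BoolFun n → ℚ} → OnSelfDual μ → ∀ i → OnSelfDual (growth μ α i)
growth-onSelfDual dual on zero    = on
growth-onSelfDual dual on (suc i) = step-onSelfDual dual (growth-onSelfDual dual on i)

-- Point masses from moments

-- The indicator of agreement at the points of H, as a product of the
-- indicators at the single points.
agreement : List (Vec Bool n) → BoolFun (suc n) → BoolFun (suc n) → ℚ
agreement []      f g = 1ℚ
agreement (x ∷ H) f g = (½ * (1ℚ + sign (f (true ∷ x)) * sign (g (true ∷ x)))) * agreement H f g

agreement-≗ : ∀ (H : List (Vec Bool n)) {f g} → f ≗ g → agreement H f g ≡ 1ℚ
agreement-≗ []      f≗g = refl
agreement-≗ (x ∷ H) {f} {g} f≗g = cong₂ (λ a b → (½ * (1ℚ + a)) * b)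
  (trans (cong (λ b → sign b * sign (g (true ∷ x))) (f≗g (true ∷ x))) (sign² (g (true ∷ x)))) (agreement-≗ H f≗g)

agreement≡0⊎≡ : ∀ (H : List (Vec Bool n)) f g →
  agreement H f g ≡ 0ℚ ⊎ (∀ {x} → x ∈ H → f (true ∷ x) ≡ g (true ∷ x))
agreement≡0⊎≡ []      f g = inj₂ λ ()
agreement≡0⊎≡ (x ∷ H) f g with f (true ∷ x) in f≡ | g (true ∷ x) in g≡ | agreement≡0⊎≡ H f g
... | a     | b     | inj₁ eq = inj₁ (trans (cong ((½ * (1ℚ + sign a * sign b)) *_) eq) (*-zeroʳ (½ * (1ℚ + sign a * sign b))))
... | true  | false | inj₂ _  = inj₁ (*-zeroˡ (agreement H f g))
... | false | true  | inj₂ _  = inj₁ (*-zeroˡ (agreement H f g))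
... | true  | true  | inj₂ eq = inj₂ λ { (here refl) → trans f≡ (sym g≡) ; (there x∈) → eq x∈ }
... | false | false | inj₂ eq = inj₂ λ { (here refl) → trans f≡ (sym g≡) ; (there x∈) → eq x∈ }

-- A self-dual function is determined by its restriction to the half cube.
selfDual-≗ : ∀ {f g : BoolFun (suc n)} → SelfDual f → SelfDual g → (∀ x → f (true ∷ x) ≡ g (true ∷ x)) → f ≗ g
selfDual-≗ f-dual g-dual half = ≗-split half
  (λ x → trans (f-dual (false ∷ x)) (trans (cong not (half (Vec.map not x))) (sym (g-dual (false ∷ x)))))

mass≡E-agreement : ∀ {p : BoolFun (suc n) → ℚ} → IsDistribution p → OnSelfDual p → ∀ f → SelfDual f →
  p f ≡ E p (agreement (cube n) f)
mass≡E-agreement {n} {p} dist on f f-dual = trans (sym (sum-≗? (IsDistribution.cong dist) f))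
  (sum-cong (boolFuns (suc n)) term)
  where
  term : ∀ g → (if does (f ≗? g) then p g else 0ℚ) ≡ p g * agreement (cube n) f g
  term g with if-cases (f ≗? g) (p g) 0ℚ | agreement≡0⊎≡ (cube n) f g | on g
  ... | inj₁ (f≗g , e) | _       | _       = trans e (sym (trans (cong (p g *_) (agreement-≗ (cube n) f≗g)) (*-identityʳ (p g))))
  ... | inj₂ (_ , e)   | inj₁ eq | _       = trans e (sym (trans (cong (p g *_) eq) (*-zeroʳ (p g))))
  ... | inj₂ (_ , e)   | inj₂ _  | inj₁ eq = trans e (sym (trans (cong (_* agreement (cube n) f g) eq) (*-zeroˡ (agreement (cube n) f g))))
  ... | inj₂ (f≗̸g , _) | inj₂ eq | inj₂ d  = contradiction (selfDual-≗ f-dual d (λ x → eq (∈-cube x))) f≗̸g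

∣average∣≤ : ∀ p b q ε → ∣ p ∣ ≤ ε → ∣ q ∣ ≤ ε → ∣ ½ * (p + sign b * q) ∣ ≤ ε
∣average∣≤ p b q ε ∣p∣≤ε ∣q∣≤ε = begin
  ∣ ½ * (p + sign b * q) ∣       ≡⟨ ∣p*q∣≡∣p∣*∣q∣ ½ (p + sign b * q) ⟩
  ½ * ∣ p + sign b * q ∣         ≤⟨ *-monoˡ-≤ 0≤½ (∣p+q∣≤∣p∣+∣q∣ p (sign b * q)) ⟩
  ½ * (∣ p ∣ + ∣ sign b * q ∣)   ≡⟨ cong (λ x → ½ * (∣ p ∣ + x)) (∣sign*∣ b q) ⟩
  ½ * (∣ p ∣ + ∣ q ∣)            ≤⟨ *-monoˡ-≤ 0≤½ (+-mono-≤ ∣p∣≤ε ∣q∣≤ε) ⟩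
  ½ * (ε + ε)                    ≡⟨ solve 1 (λ e → con ½ :* (e :+ e) := e) refl ε ⟩
  ε                              ∎
  where open ≤-Reasoning

module _ {p : BoolFun (suc n) → ℚ} (f : BoolFun (suc n)) where

  E-charac-agreement-∷ : ∀ S x H → E p (λ g → charac S g * agreement (x ∷ H) f g) ≡
    ½ * (E p (λ g → charac S g * agreement H f g) +
         sign (f (true ∷ x)) * E p (λ g → charac (x ∷ S) g * agreement H f g))
  E-charac-agreement-∷ S x H = begin
    ∑[ g ∈ fs ] p g * (charac S g * agreement (x ∷ H) f g)
      ≡⟨ sum-cong fs (λ g → solve 5 (λ p c s t a →
           p :* (c :* ((con ½ :* (con 1ℚ :+ s :* t)) :* a)) := con ½ :* (p :* (c :* a) :+ s :* (p :* ((t :* c) :* a))))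
           refl (p g) (charac S g) (sign (f (true ∷ x))) (sign (g (true ∷ x))) (agreement H f g)) ⟩
    ∑[ g ∈ fs ] ½ * (p g * (charac S g * agreement H f g) + sign (f (true ∷ x)) * (p g * (charac (x ∷ S) g * agreement H f g)))
      ≡⟨ sum-*ˡ fs ½ _ ⟩
    ½ * (∑[ g ∈ fs ] (p g * (charac S g * agreement H f g) + sign (f (true ∷ x)) * (p g * (charac (x ∷ S) g * agreement H f g))))
      ≡⟨ cong (½ *_) (trans (sum-+ fs _ _) (cong (_+_ (E p (λ g → charac S g * agreement H f g)))
           (sum-*ˡ fs (sign (f (true ∷ x))) _))) ⟩
    ½ * (E p (λ g → charac S g * agreement H f g) + sign (f (true ∷ x)) * E p (λ g → charac (x ∷ S) g * agreement H f g)) ∎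
    where
    open ≡-Reasoning
    fs : List (BoolFun (suc n))
    fs = boolFuns (suc n)

  module _ {m ε} (few : ∀ U → U ≢ [] → Unique U → length U ℕ.≤ m → ∣ moment p U ∣ ≤ ε) where

    ∣E-charac-agreement∣≤ : ∀ H S → S ≢ [] → Unique (S ++ H) → length (S ++ H) ℕ.≤ m →
      ∣ E p (λ g → charac S g * agreement H f g) ∣ ≤ ε
    ∣E-charac-agreement∣≤ []      S S≢[] u l = ≤-trans
      (≤-reflexive (cong ∣_∣ (E-cong p (λ g → *-identityʳ (charac S g)))))
      (few S S≢[] (subst Unique (++-identityʳ S) u) (subst (λ V → length V ℕ.≤ m) (++-identityʳ S) l))
    ∣E-charac-agreement∣≤ (x ∷ H) S S≢[] u l = ≤-trans
      (≤-reflexive (cong ∣_∣ (E-charac-agreement-∷ S x H)))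
      (∣average∣≤ _ (f (true ∷ x)) _ ε
        (∣E-charac-agreement∣≤ H S S≢[] (tail-Unique u′) (ℕ.≤-trans (ℕ.n≤1+n _) l′))
        (∣E-charac-agreement∣≤ H (x ∷ S) (λ ()) u′ l′))
      where
      u′ : Unique (x ∷ S ++ H)
      u′ = Unique-shift S x H u
      l′ : length (x ∷ S ++ H) ℕ.≤ m
      l′ = subst (ℕ._≤ m) (length-shift S x H) l

    -- If the moments were 0, the values at the points of H would be
    -- independent and uniform.
    ∣E-agreement-½^∣≤ : 0ℚ ≤ ε → IsDistribution p → ∀ H → Unique H → length H ℕ.≤ m →
      ∣ E p (agreement H f) - ½ ^ length H ∣ ≤ ε
    ∣E-agreement-½^∣≤ 0≤ε dist []      u l = ≤-trans
      (≤-reflexive (cong (λ x → ∣ x - 1ℚ ∣) (E-1 dist))) 0≤ε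
    ∣E-agreement-½^∣≤ 0≤ε dist (x ∷ H) u l = ≤-trans
      (≤-reflexive (cong ∣_∣ (begin
        E p (agreement (x ∷ H) f) - ½ * h
          ≡⟨ cong (λ y → y - ½ * h) (trans (E-cong p (λ g → sym (*-identityˡ (agreement (x ∷ H) f g)))) (E-charac-agreement-∷ [] x H)) ⟩
        ½ * (E p (λ g → 1ℚ * agreement H f g) + s * e) - ½ * h
          ≡⟨ cong (λ y → ½ * (y + s * e) - ½ * h) (E-cong p (λ g → *-identityˡ (agreement H f g))) ⟩
        ½ * (E p (agreement H f) + s * e) - ½ * h
          ≡⟨ solve 4 (λ a s e h → con ½ :* (a :+ s :* e) :- con ½ :* h := con ½ :* ((a :- h) :+ s :* e))
               refl (E p (agreement H f)) s e h ⟩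
        ½ * ((E p (agreement H f) - h) + s * e) ∎)))
      (∣average∣≤ _ (f (true ∷ x)) _ ε
        (∣E-agreement-½^∣≤ 0≤ε dist H (tail-Unique u) (ℕ.≤-trans (ℕ.n≤1+n _) l))
        (∣E-charac-agreement∣≤ H (x ∷ []) (λ ()) u l))
      where
      open ≡-Reasoning
      s e h : ℚ
      s = sign (f (true ∷ x))
      e = E p (λ g → charac (x ∷ []) g * agreement H f g)
      h = ½ ^ length H

cube-Unique : ∀ n → Unique (cube n)
cube-Unique zero    = [] ∷ []
cube-Unique (suc n) = cartesianProductWith⁺ _∷_ ∷-injective (((λ ()) ∷ []) ∷ [] ∷ []) (cube-Unique n)

-- The limiting distribution

module Limit {α : BoolFun k} (nonlinear : ¬ Linear α) (dual : SelfDual α)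
             {μ : BoolFun (suc n) → ℚ} (uniform : IsUniformOver Literal μ) where
  open Decay nonlinear dual uniform

  H : List (Vec Bool n)
  H = cube n

  -- There are 2 ^ length H self-dual functions.
  mass : ℚ
  mass = ½ ^ length H

  0<mass : 0ℚ < mass
  0<mass = positive (length H)
    where
    positive : ∀ m → 0ℚ < ½ ^ m
    positive zero    = 0<1
    positive (suc m) = 0<* 0<½ (positive m)

  -- The uniform distribution on the self-dual functions.
  π : BoolFun (suc n) → ℚ
  π f = if does (selfDual? f) then mass else 0ℚ

  π-cases : ∀ f → SelfDual f × π f ≡ mass ⊎ (¬ SelfDual f) × π f ≡ 0ℚ
  π-cases f = if-cases (selfDual? f) mass 0ℚ

  onSelfDual : ∀ i → OnSelfDual (growth μ α i)
  onSelfDual = growth-onSelfDual dual μ-on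
    where
    μ-on : OnSelfDual μ
    μ-on f with μ f ≟ 0ℚ
    ... | yes eq = inj₁ eq
    ... | no ≢0  = inj₂ (literal-selfDual (Equivalence.to (IsUniformOver.support uniform f) ≢0))

  converges : ∀ ε → 0ℚ < ε → ∃ λ N → ∀ i → i ℕ.≥ N → ∀ f → ∣ growth μ α i f - π f ∣ ≤ ε
  converges ε 0<ε = proj₁ (decays (length H) ε 0<ε) , λ i i≥N f → close i (proj₂ (decays (length H) ε 0<ε) i i≥N) f
    where
    close : ∀ i → (∀ U → U ≢ [] → Unique U → length U ℕ.≤ length H → ∣ M i U ∣ ≤ ε) →
            ∀ f → ∣ growth μ α i f - π f ∣ ≤ ε
    close i few f = cases (π-cases f) (onSelfDual i f)
      where
      cases : SelfDual f × π f ≡ mass ⊎ (¬ SelfDual f) × π f ≡ 0ℚ → growth μ α i f ≡ 0ℚ ⊎ SelfDual f →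
              ∣ growth μ α i f - π f ∣ ≤ ε
      cases (inj₁ (d , e))  _         = ≤-trans
        (≤-reflexive (cong₂ (λ x y → ∣ x - y ∣) (mass≡E-agreement (dist i) (onSelfDual i) f d) e))
        (∣E-agreement-½^∣≤ f few (<⇒≤ 0<ε) (dist i) H (cube-Unique n) ℕ.≤-refl)
      cases (inj₂ (_ , e))  (inj₁ eq) = ≤-trans (≤-reflexive (cong₂ (λ x y → ∣ x - y ∣) eq e)) (<⇒≤ 0<ε)
      cases (inj₂ (¬d , _)) (inj₂ d)  = contradiction d ¬d

  fs : List (BoolFun (suc n))
  fs = boolFuns (suc n)

  -- A pointwise limit of distributions on a finite set is a distribution.
  π-total : sum fs π ≡ 1ℚ
  π-total = sym (begin
    1ℚ                         ≡⟨ solve 1 (λ x → con 1ℚ := (con 1ℚ :- x) :+ x) refl (sum fs π) ⟩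
    (1ℚ - sum fs π) + sum fs π ≡⟨ cong (_+ sum fs π) (∣p∣≤all⇒p≡0 close) ⟩
    0ℚ + sum fs π              ≡⟨ +-identityˡ (sum fs π) ⟩
    sum fs π                   ∎)
    where
    open ≡-Reasoning
    close : ∀ δ → 0ℚ < δ → ∣ 1ℚ - sum fs π ∣ ≤ δ
    close δ 0<δ = near (scale-down (sum fs (λ _ → 1ℚ)) (sum-nonNeg fs (λ _ → 0≤1)) δ 0<δ)
      where
      near : (∃ λ ε → 0ℚ < ε × sum fs (λ _ → 1ℚ) * ε ≤ δ) → ∣ 1ℚ - sum fs π ∣ ≤ δ
      near (ε , 0<ε , scaled) = let N , ≤ε = converges ε 0<ε in ≤-trans
        (≤-reflexive (cong ∣_∣ (trans (cong (λ y → y - sum fs π) (sym (IsDistribution.total (dist N))))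
                                      (sym (sum-- fs (growth μ α N) π)))))
        (≤-trans (∣sum∣≤sum∣∣ fs (λ f → growth μ α N f - π f))
        (≤-trans (sum-mono fs (λ f → ≤-trans (≤ε N ℕ.≤-refl f) (≤-reflexive (sym (*-identityˡ ε)))))
        (≤-trans (≤-reflexive (sum-*ʳ fs ε (λ _ → 1ℚ))) scaled)))

  π-isDistribution : IsDistribution π
  π-isDistribution = record
    { cong   = λ {f} {g} f≗g → cong (λ b → if b then mass else 0ℚ)
        (does-⇔ (mk⇔ (selfDual-resp f≗g) (selfDual-resp (sym ∘ f≗g))) (selfDual? f) (selfDual? g))
    ; nonNeg = nonNeg
    ; total  = π-total
    }
    where
    selfDual-resp : ∀ {f g : BoolFun (suc n)} → f ≗ g → SelfDual f → SelfDual g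
    selfDual-resp f≗g d y = trans (sym (f≗g y)) (trans (d y) (cong not (f≗g (Vec.map not y))))
    nonNeg : ∀ f → 0ℚ ≤ π f
    nonNeg f with π-cases f
    ... | inj₁ (_ , e) = ≤-trans (<⇒≤ 0<mass) (≤-reflexive (sym e))
    ... | inj₂ (_ , e) = ≤-reflexive (sym e)

  π-limit : IsLimitingDistribution μ α π
  π-limit = π-isDistribution , λ f ε 0<ε → let N , near = converges (½ * ε) (0<* 0<½ 0<ε) in
    N , λ i i≥N → ≤-<-trans (near i i≥N f) (½*p<p 0<ε)

  π-selfDual : ∀ f → SelfDual f → π f ≡ mass
  π-selfDual f d with π-cases f
  ... | inj₁ (_ , e)  = e
  ... | inj₂ (¬d , _) = contradiction d ¬d

  π-uniform : IsUniformOver SelfDual π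
  π-uniform = record
    { isDistribution = π-isDistribution
    ; support        = λ f → mk⇔ (to f) (λ d eq → <⇒≢ 0<mass (sym (trans (sym (π-selfDual f d)) eq)))
    ; constant       = λ f g f-dual g-dual → trans (π-selfDual f f-dual) (sym (π-selfDual g g-dual))
    }
    where
    to : ∀ f → π f ≢ 0ℚ → SelfDual f
    to f ≢0 with π-cases f
    ... | inj₁ (d , _) = d
    ... | inj₂ (_ , e) = contradiction e ≢0

theorem4p1 : (k n : ℕ) (α : BoolFun k) → ¬ Linear α → SelfDual α →
    (μ : BoolFun n → ℚ) → IsUniformOver Literal μ →
    ∃ λ (π : BoolFun n → ℚ) →
    IsLimitingDistribution μ α π × IsUniformOver SelfDual π
-- Without variables there are no literals, so that μ would have total mass 0.
theorem4p1 k zero    α nonlinear dual μ uniform = contradiction (trans (sym total≡0) (IsDistribution.total isDistribution)) λ ()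
  where
  open IsUniformOver uniform
  μ≡0 : ∀ f → μ f ≡ 0ℚ
  μ≡0 f with μ f ≟ 0ℚ
  ... | yes eq = eq
  ... | no ≢0 with Equivalence.to (support f) ≢0
  ...   | () , _
  total≡0 : sum (boolFuns 0) μ ≡ 0ℚ
  total≡0 = trans (sum-cong (boolFuns 0) μ≡0) (sum-0 (boolFuns 0))
theorem4p1 k (suc n) α nonlinear dual μ uniform = π , π-limit , π-uniform
  where open Limit nonlinear dual uniform
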